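{- The generating function $R(x)=\sum_{n\geq 0}|I_n(000,021)|\,x^{n+1}$ is given by $$R(x)=\frac{3x^3+x^2-3x+1}{2x^2\sqrt{(1+x)(1-3x)}}-\frac{(1-x)^2}{2x^2}=x+2x^2+5x^3+14x^4+39x^5+111x^6+317x^7+911x^8+2627x^9+7600x^{10}+\cdots.$$ Moreover, for all $n\geq 1$, $$|I_{n-1}(000,021)|=\frac12\left(3a_{n-1}+a_n-3a_{n+1}+a_{n+2}\right),$$ where $a_n=\sum_{k=0}^n(-1)^{n-k}\binom{n}{k}\binom{2k}{k}$.
   Context: For $n\ge 0$, $I_n$ denotes the set of inversion sequences $e=e_0e_1\cdots e_n$, i.e. integer sequences with $0\le e_i\le i$ for each $0\le i\le n$ (so elements of $I_n$ have $n+1$ letters). An inversion sequence contains a pattern (word) $\tau$ of length $k$ if it has a subsequence (not necessarily consecutive) of length $k$ that is order isomorphic to $\tau$ (same relative order, including equalities); otherwise it avoids $\tau$. $I_n(\tau_1,\dots,\tau_m)$ is the set of $e\in I_n$ avoiding all of $\tau_1,\dots,\tau_m$. Generating functions are formal power series in $x$ (the right-hand side is expanded as a Laurent series at $x=0$, with $\sqrt{\cdot}$ having constant term $1$). -}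

module Defs where

open import Data.Fin as Fin using (Fin; zero; suc; toℕ; inject₁; opposite)
import Data.Fin.Properties as Fin
open import Data.Integer as ℤ using (ℤ; +_; -[1+_]; -1ℤ)
import Data.Integer.Properties as ℤ
open import Data.List as List using (List; []; _∷_; length; upTo; filter; cartesianProductWith)
open import Data.List.Membership.Propositional using (_∈_)
import Data.List.Membership.Propositional.Properties as ∈
open import Data.List.Relation.Unary.All as All using (All)
open import Data.List.Relation.Unary.AllPairs as AllPairs using ()
open import Data.List.Relation.Unary.Any using (here)
open import Data.List.Relation.Unary.Unique.Propositional using (Unique)
import Data.List.Relation.Unary.Unique.Propositional.Properties as Unique
open import Data.Nat as ℕ using (ℕ; zero; suc; _≤_; _<_; _∸_)
open import Data.Nat.Combinatorics using (_C_)
import Data.Nat.Properties as ℕ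
open import Data.Product using (_×_; _,_; proj₁; proj₂; ∃; ∃-syntax)
open import Data.Rational as ℚ using (ℚ; 0ℚ; 1ℚ; ½)
open import Data.Rational.Literals using (fromℤ)
import Data.Rational.Properties as ℚ
open import Data.Vec as Vec using (Vec; []; _∷_; lookup)
import Data.Vec.Properties as Vec
open import Function using (_∘_; _⇔_; mk⇔; Equivalence)
open import Relation.Binary.PropositionalEquality
  using (_≡_; _≗_; refl; sym; trans; cong; cong₂; module ≡-Reasoning)
open import Relation.Nullary using (¬_; Dec; ¬?; _×-dec_; _→-dec_)
open import Relation.Nullary.Decidable using (map′)
open import Relation.Unary using (Decidable)
open import Algebra.Properties.CommutativeMonoid.Sum ℚ.+-0-commutativeMonoid
  using (sum; sum-cong-≗; sum-init-last; sum⁺-syntax; sum-syntax)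

OrderIsomorphic : ∀ {k} → Vec ℕ k → Vec ℕ k → Set
OrderIsomorphic u v = ∀ i j →
  (lookup u i < lookup u j ⇔ lookup v i < lookup v j) ×
  (lookup u i ≡ lookup u j ⇔ lookup v i ≡ lookup v j)

Increasing : ∀ {k m} → Vec (Fin m) k → Set
Increasing p = ∀ i j → i Fin.< j → lookup p i Fin.< lookup p j

Pattern : Set
Pattern = List ℕ

-- The vector p lists the positions of the letters of an occurrence of τ.
Contains : ∀ {m} → Vec ℕ m → Pattern → Set
Contains {m} e τ = ∃[ p ] Increasing {length τ} {m} p ×
  OrderIsomorphic (Vec.map (lookup e) p) (Vec.fromList τ)

Avoids : ∀ {m} → Vec ℕ m → Pattern → Set
Avoids e τ = ¬ Contains e τ

IsInversionSequence : ∀ {m} → Vec ℕ m → Set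
IsInversionSequence e = ∀ i → lookup e i ≤ toℕ i

-- The elements of Iₙ have n + 1 letters e₀ e₁ ⋯ eₙ.
I : (n : ℕ) → List Pattern → Vec ℕ (suc n) → Set
I n τs e = IsInversionSequence e × All (Avoids e) τs

record Enumeration {A : Set} (P : A → Set) : Set where
  field
    elements : List A
    unique   : Unique elements
    sound    : ∀ {x} → x ∈ elements → P x
    complete : ∀ {x} → P x → x ∈ elements

∣_∣ : {A : Set} {P : A → Set} → Enumeration P → ℕ
∣ E ∣ = length (Enumeration.elements E)

infix 2 _⇔-dec_
_⇔-dec_ : {A B : Set} → Dec A → Dec B → Dec (A ⇔ B)
a? ⇔-dec b? = map′ (λ (f , g) → mk⇔ f g)
                   (λ eq → Equivalence.to eq , Equivalence.from eq)
                   ((a? →-dec b?) ×-dec (b? →-dec a?))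

anyVec? : ∀ {m} k {P : Vec (Fin m) k → Set} → Decidable P → Dec (∃ P)
anyVec? zero    P? = map′ (λ p → [] , p) (λ { ([] , p) → p }) (P? [])
anyVec? (suc k) P? =
  map′ (λ (i , is , p) → i ∷ is , p) (λ { (i ∷ is , p) → i , is , p })
       (Fin.any? λ i → anyVec? k λ is → P? (i ∷ is))

orderIsomorphic? : ∀ {k} (u v : Vec ℕ k) → Dec (OrderIsomorphic u v)
orderIsomorphic? u v = Fin.all? λ i → Fin.all? λ j →
  (lookup u i ℕ.<? lookup u j ⇔-dec lookup v i ℕ.<? lookup v j) ×-dec
  (lookup u i ℕ.≟ lookup u j ⇔-dec lookup v i ℕ.≟ lookup v j)

increasing? : ∀ {k m} (p : Vec (Fin m) k) → Dec (Increasing p)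
increasing? p = Fin.all? λ i → Fin.all? λ j →
  (i Fin.<? j) →-dec (lookup p i Fin.<? lookup p j)

avoids? : ∀ {m} (e : Vec ℕ m) → Decidable (Avoids e)
avoids? e τ = ¬? (anyVec? (length τ) λ p →
  increasing? p ×-dec orderIsomorphic? (Vec.map (lookup e) p) (Vec.fromList τ))

box : ∀ {m} → (Fin m → ℕ) → List (Vec ℕ m)
box {zero}  b = [] ∷ []
box {suc m} b = cartesianProductWith _∷_ (upTo (suc (b zero))) (box (b ∘ suc))

box-unique : ∀ {m} (b : Fin m → ℕ) → Unique (box b)
box-unique {zero}  b = All.[] AllPairs.∷ AllPairs.[]
box-unique {suc m} b =
  Unique.cartesianProductWith⁺ _∷_ Vec.∷-injective
    (Unique.upTo⁺ (suc (b zero))) (box-unique (b ∘ suc))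

box-sound : ∀ {m} (b : Fin m → ℕ) {e} → e ∈ box b → ∀ i → lookup e i ≤ b i
box-sound {suc m} b e∈ i
  with ∈.∈-cartesianProductWith⁻ _∷_ (upTo (suc (b zero))) (box (b ∘ suc)) e∈
... | x , xs , x∈ , xs∈ , refl with i
...   | zero  = ℕ.s≤s⁻¹ (∈.∈-upTo⁻ x∈)
...   | suc j = box-sound (b ∘ suc) xs∈ j

box-complete : ∀ {m} (b : Fin m → ℕ) {e} → (∀ i → lookup e i ≤ b i) → e ∈ box b
box-complete {zero}  b {[]}    e≤b = here refl
box-complete {suc m} b {_ ∷ _} e≤b =
  ∈.∈-cartesianProductWith⁺ _∷_ (∈.∈-upTo⁺ (ℕ.s≤s (e≤b zero)))
                                (box-complete (b ∘ suc) (e≤b ∘ suc))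

enumerate : ∀ n τs → Enumeration (I n τs)
enumerate n τs = record
  { elements = filter avoidsAll? (box toℕ)
  ; unique   = Unique.filter⁺ avoidsAll? (box-unique toℕ)
  ; sound    = λ e∈ → let e∈box , av = ∈.∈-filter⁻ avoidsAll? e∈ in
                      box-sound toℕ e∈box , av
  ; complete = λ (inv , av) → ∈.∈-filter⁺ avoidsAll? (box-complete toℕ inv) av
  }
  where
  avoidsAll? : Decidable (λ (e : Vec ℕ (suc n)) → All (Avoids e) τs)
  avoidsAll? e = All.all? (avoids? e) τs

∣I∣ : ℕ → List Pattern → ℕ
∣I∣ n τs = ∣ enumerate n τs ∣

Series : Set
Series = ℕ → ℚ

con : ℕ → Series
con c zero    = fromℤ (+ c)
con c (suc _) = 0ℚ

X : Series
X 1 = 1ℚ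
X _ = 0ℚ

infixl 6 _⊕_ _⊖_
infixl 7 _⊛_ _⊘_
infixr 8 _^^_

_⊕_ _⊖_ _⊛_ : Series → Series → Series
(f ⊕ g) n = f n ℚ.+ g n
(f ⊖ g) n = f n ℚ.- g n
(f ⊛ g) n = ∑[ k ≤ n ] (f (toℕ k) ℚ.* g (n ∸ toℕ k))

_^^_ : Series → ℕ → Series
f ^^ zero  = con 1
f ^^ suc n = f ⊛ f ^^ n

-- Long division: if q₀ = f₀ / g₀ then f / g = q₀ + x · (((f - q₀ g) / x) / g).
_⊘_ : (f g : Series) → .{{ℚ.NonZero (g 0)}} → Series
(f ⊘ g) zero    = f 0 ℚ.÷ g 0
(f ⊘ g) (suc n) = ((λ m → f (suc m) ℚ.- (f 0 ℚ.÷ g 0) ℚ.* g (suc m)) ⊘ g) n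

⊘-correct : ∀ f g .{{_ : ℚ.NonZero (g 0)}} → (f ⊘ g) ⊛ g ≗ f
⊘-correct f g zero = begin
  f 0 ℚ.* ℚ.1/ g 0 ℚ.* g 0 ℚ.+ 0ℚ ≡⟨ ℚ.+-identityʳ _ ⟩
  f 0 ℚ.* ℚ.1/ g 0 ℚ.* g 0        ≡⟨ ℚ.*-assoc (f 0) _ (g 0) ⟩
  f 0 ℚ.* (ℚ.1/ g 0 ℚ.* g 0)      ≡⟨ cong (f 0 ℚ.*_) (ℚ.*-inverseˡ (g 0)) ⟩
  f 0 ℚ.* 1ℚ                      ≡⟨ ℚ.*-identityʳ (f 0) ⟩
  f 0                             ∎
  where open ≡-Reasoning
⊘-correct f g (suc n) = begin
  c ℚ.+ ((f′ ⊘ g) ⊛ g) n          ≡⟨ cong (c ℚ.+_) (⊘-correct f′ g n) ⟩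
  c ℚ.+ (f (suc n) ℚ.- c)         ≡⟨ ℚ.+-comm c _ ⟩
  f (suc n) ℚ.- c ℚ.+ c           ≡⟨ ℚ.+-assoc (f (suc n)) (ℚ.- c) c ⟩
  f (suc n) ℚ.+ (ℚ.- c ℚ.+ c)     ≡⟨ cong (f (suc n) ℚ.+_) (ℚ.+-inverseˡ c) ⟩
  f (suc n) ℚ.+ 0ℚ                ≡⟨ ℚ.+-identityʳ _ ⟩
  f (suc n)                       ∎
  where
  open ≡-Reasoning
  f′ : Series
  f′ m = f (suc m) ℚ.- (f 0 ℚ.÷ g 0) ℚ.* g (suc m)
  c = (f 0 ℚ.÷ g 0) ℚ.* g (suc n)

-- Meaningful when f₀ = 1: then √ f is the square root with constant term 1.
-- √-prefix lists the coefficients sₙ, …, s₁, s₀ = 1 of that root s, determined by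
-- 2 sₙ₊₁ + ∑_{i<n} sₙ₋ᵢ sᵢ₊₁ = fₙ₊₁.
√-prefix : Series → ∀ n → Vec ℚ (suc n)
√-prefix f zero    = 1ℚ ∷ []
√-prefix f (suc n) = ½ ℚ.* (f (suc n) ℚ.- middle) ∷ s
  where
  s = √-prefix f n
  middle = ∑[ i < n ] (lookup s (inject₁ i) ℚ.* lookup s (inject₁ (opposite i)))

√ : Series → Series
√ f n = Vec.head (√-prefix f n)

√-prefix-lookup : ∀ f n i → lookup (√-prefix f n) i ≡ √ f (n ∸ toℕ i)
√-prefix-lookup f zero    zero    = refl
√-prefix-lookup f (suc n) zero    = refl
√-prefix-lookup f (suc n) (suc i) = √-prefix-lookup f n i

√-correct : ∀ f → f 0 ≡ 1ℚ → √ f ⊛ √ f ≗ f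
√-correct f f₀≡1 zero    = sym f₀≡1
√-correct f f₀≡1 (suc n) = begin
  1ℚ ℚ.* a ℚ.+ ∑[ k ≤ n ] t k
    ≡⟨ cong₂ ℚ._+_ (ℚ.*-identityˡ a) (sum-init-last t) ⟩
  a ℚ.+ (sum (t ∘ inject₁) ℚ.+ t (Fin.fromℕ n))
    ≡⟨ cong (a ℚ.+_) (cong₂ ℚ._+_ (sum-cong-≗ inner) outer) ⟩
  a ℚ.+ (M ℚ.+ a)                 ≡⟨ cong (a ℚ.+_) (ℚ.+-comm M a) ⟩
  a ℚ.+ (a ℚ.+ M)                 ≡⟨ ℚ.+-assoc a a M ⟨
  a ℚ.+ a ℚ.+ M                   ≡⟨ cong (ℚ._+ M) (ℚ.*-distribʳ-+ b ½ ½) ⟨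
  1ℚ ℚ.* b ℚ.+ M                  ≡⟨ cong (ℚ._+ M) (ℚ.*-identityˡ b) ⟩
  f (suc n) ℚ.- M ℚ.+ M           ≡⟨ ℚ.+-assoc (f (suc n)) (ℚ.- M) M ⟩
  f (suc n) ℚ.+ (ℚ.- M ℚ.+ M)     ≡⟨ cong (f (suc n) ℚ.+_) (ℚ.+-inverseˡ M) ⟩
  f (suc n) ℚ.+ 0ℚ                ≡⟨ ℚ.+-identityʳ _ ⟩
  f (suc n)                       ∎
  where
  open ≡-Reasoning
  a = √ f (suc n)
  t : Fin (suc n) → ℚ
  t k = √ f (suc (toℕ k)) ℚ.* √ f (n ∸ toℕ k)
  s = √-prefix f n
  M = ∑[ i < n ] (lookup s (inject₁ i) ℚ.* lookup s (inject₁ (opposite i)))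
  b = f (suc n) ℚ.- M

  index : (i : Fin n) → n ∸ toℕ (inject₁ (opposite i)) ≡ suc (toℕ i)
  index i = trans (cong (n ∸_) (trans (Fin.toℕ-inject₁ (opposite i)) (Fin.opposite-prop i)))
                  (ℕ.m∸[m∸n]≡n (Fin.toℕ<n i))

  inner : ∀ i → t (inject₁ i) ≡ lookup s (inject₁ i) ℚ.* lookup s (inject₁ (opposite i))
  inner i = trans (ℚ.*-comm (√ f (suc (toℕ (inject₁ i)))) _)
    (cong₂ ℚ._*_
      (sym (√-prefix-lookup f n (inject₁ i)))
      (trans (cong (√ f ∘ suc) (Fin.toℕ-inject₁ i))
             (sym (trans (√-prefix-lookup f n (inject₁ (opposite i))) (cong (√ f) (index i))))))

  outer : t (Fin.fromℕ n) ≡ a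
  outer = trans
    (cong₂ ℚ._*_ (cong (√ f ∘ suc) (Fin.toℕ-fromℕ n))
                 (cong (√ f) (trans (cong (n ∸_) (Fin.toℕ-fromℕ n)) (ℕ.n∸n≡0 n))))
    (ℚ.*-identityʳ a)

-- x^ v · f may have f 0 ≡ 0ℚ, so representations are not unique; compare with _≈_.
infix 5 x^_·_
record Laurent : Set where
  constructor x^_·_
  field
    exponent : ℤ
    series   : Series
open Laurent public

coeff : Laurent → ℤ → ℚ
coeff (x^ v · f) m with m ℤ.- v
... | + n      = f n
... | -[1+ _ ] = 0ℚ

infix 3 _≈_
infixl 4 _⊟_
infix 4.5 _⊡_

_≈_ : Laurent → Laurent → Set
a ≈ b = ∀ m → coeff a m ≡ coeff b m

-- All coefficients below the smaller of the two exponents vanish.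
_⊟_ : Laurent → Laurent → Laurent
a ⊟ b = x^ w · λ n → coeff a (w ℤ.+ + n) ℚ.- coeff b (w ℤ.+ + n)
  where w = exponent a ℤ.⊓ exponent b

_⊡_ : (a b : Laurent) → .{{ℚ.NonZero (series b 0)}} → Laurent
(x^ v · f) ⊡ (x^ w · g) = x^ (v ℤ.- w) · (f ⊘ g)

τ₀₀₀ τ₀₂₁ : Pattern
τ₀₀₀ = 0 ∷ 0 ∷ 0 ∷ []
τ₀₂₁ = 0 ∷ 2 ∷ 1 ∷ []

-- R(x) = ∑_{n ≥ 0} ∣Iₙ(000,021)∣ xⁿ⁺¹
R : Series
R zero    = 0ℚ
R (suc n) = fromℤ (+ ∣I∣ n (τ₀₀₀ ∷ τ₀₂₁ ∷ []))

a : ℕ → ℤ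
a n = sumℤ λ (k : Fin (suc n)) →
        -1ℤ ℤ.^ (n ∸ toℕ k) ℤ.* + (n C toℕ k) ℤ.* + ((2 ℕ.* toℕ k) C toℕ k)
  where
  open import Algebra.Properties.CommutativeMonoid.Sum ℤ.+-0-commutativeMonoid
    renaming (sum to sumℤ) using ()

{-# OPTIONS --safe #-}
module Submission where

-- Why the theorem holds.
--
-- Counting.  An inversion sequence starts with 0, so it avoids 021 exactly when
-- its nonzero letters increase weakly, and it avoids 000 exactly when no letter
-- occurs more than twice (avoids-021⇔, avoids-000⇔).  Such sequences are read
-- from left to right.  With v the largest letter so far and the next letter at
-- most v + d, the number of ways to append m further letters depends only on m,
-- on d, on the number p of copies of v still available and on the number q of
-- zeros still available; call it c(m, d, p, q), with p = 0 as long as v = 0.  The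
-- next letter is 0, or v, or one of v + 1, …, v + d, whence
--   c(m+1, d, p, q) = [q > 0] c(m, d+1, p, q-1) + [p > 0] c(m, d+1, p-1, q)
--                     + c(m, d, 1, q) + … + c(m, 1, 1, q)
-- and the number of sequences with n + 1 letters is c(n+1, 0, 0, 2)
-- (length-accepted, ∣I∣-completions).
--
-- Closed form.  Let T(n, j) be the coefficient of y^j in (y⁻¹ + 1 + y)^n.  For
-- p, q ≤ 1 the numbers c(m, d+1, p, q) are combinations of the T(m+d, d+j) with
-- coefficients of degree at most one in d; the recurrence verifies them
-- (closedForms).  In particular
--   c(n+1, 0, 0, 2) = c(n, 1, 0, 1) = T(n, 0) + T(n, 1) + T(n, 3).
--
-- Central coefficients.  Since y⁻¹ + 1 + y = (y^½ + y^-½)² - 1, the binomial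
-- theorem gives T(n, j) = ∑ (-1)^(n-k) C(n, k) C(2k, k+j), so that a_n = T(n, 0)
-- (difference-evenBinomial).  Unfolding three rows of the trinomial triangle,
--   3 a_n + a_{n+1} - 3 a_{n+2} + a_{n+3} = 2 (T(n, 0) + T(n, 1) + T(n, 3)),
-- which is the explicit formula (count-formula).
--
-- Generating function.  Put S = √((1+x)(1-3x)) and write S = 1 - x - 2xY.  Then
-- S² = (1+x)(1-3x) amounts to Y = x (1 + Y + Y²), so the series Y^j / S satisfy
-- the recurrence of the columns ∑ T(n, j) x^n, which determines them.  Hence 1/S
-- is the generating function of a_n (Central.A-coefficient), and the stated
-- Laurent series is read off coefficientwise: those of x⁻², x⁻¹ and x⁰ cancel,
-- the others are given by the explicit formula.

open import Data.Integer as ℤ using (+_)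
open import Data.List using ([]; _∷_; map; applyUpTo)
open import Data.Nat using (ℕ; _+_; _∸_; _≤_)
open import Data.Product using (_×_)
open import Data.Rational as ℚ using (½)
open import Data.Rational.Literals using (fromℤ)
open import Relation.Binary.PropositionalEquality using (_≡_)
open import Defs

open import Algebra.Bundles using (CommutativeRing)
import Algebra.Solver.Ring
open import Algebra.Solver.Ring.AlmostCommutativeRing
  using (fromCommutativeRing; _-Raw-AlmostCommutative⟶_)
open import Data.Empty using (⊥-elim)
open import Data.Fin as Fin using (Fin; zero; suc; toℕ; fromℕ)
open import Data.Fin.Patterns using (0F; 1F; 2F)
import Data.Fin.Properties as Fin
open import Data.Integer using (ℤ; -[1+_]; -1ℤ)
import Data.Integer.Properties as ℤ
import Data.Integer.Tactic.RingSolver as ℤ-Ring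
open import Data.List using (List; length; filter; upTo; cartesianProductWith; _++_)
open import Data.List.Membership.Propositional using (_∈_)
import Data.List.Properties as List
open import Data.List.Relation.Unary.All using (All; []; _∷_)
open import Data.List.Relation.Unary.Any using (here; there)
open import Data.Maybe using (Maybe; nothing; just)
open import Data.Nat as ℕ using (zero; suc; pred; _<_; _⊔_; z≤n; s≤s; _≟_; _≤?_; _<?_)
open import Data.Nat.Combinatorics
  using (_C_; nCk+nC[k+1]≡[n+1]C[k+1]; nCk≡nC[n∸k]; k>n⇒nCk≡0; nCn≡1)
open import Data.Nat.ListAction using (sum)
import Data.Nat.Properties as ℕ
open import Data.Product using (_,_; proj₁; proj₂; ∃; ∃-syntax)
open import Data.Rational using (ℚ; 0ℚ; 1ℚ)
import Data.Rational.Properties as ℚ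
open import Data.Rational.Solver using (module +-*-Solver)
open import Data.Sum using (inj₁; inj₂)
open import Data.Unit using (⊤; tt)
open import Data.Vec as Vec using (Vec; []; _∷_; lookup)
open import Function using (_∘_; _⇔_; mk⇔; Equivalence; const)
open import Level using (0ℓ)
open import Relation.Binary.Bundles using (Setoid)
open import Relation.Binary.PropositionalEquality
  using (_≗_; _≢_; refl; sym; trans; cong; cong₂; subst; subst₂; ≢-sym; _→-setoid_; module ≡-Reasoning)
import Relation.Binary.Reasoning.Setoid as SetoidReasoning
open import Relation.Nullary using (¬_; Dec; yes; no; contradiction; _×-dec_; _→-dec_)
open import Relation.Unary using (Decidable)

open import Algebra.Properties.CommutativeMonoid.Sum ℤ.+-0-commutativeMonoid using ()
  renaming (sum to sumℤ; sum-cong-≗ to sumℤ-cong; ∑-distrib-+ to sumℤ-+;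
            sum-init-last to sumℤ-init-last)

-- Avoidance of 000 and 021

-- The order of x and y is the same as that of x′ and y′.
OrderAgrees : (x y x′ y′ : ℕ) → Set
OrderAgrees x y x′ y′ = (x < y ⇔ x′ < y′) × (x ≡ y ⇔ x′ ≡ y′)

module _ {x y x′ y′ : ℕ} where
  agree-< : x < y → x′ < y′ → OrderAgrees x y x′ y′
  agree-< p q = mk⇔ (const q) (const p)
              , mk⇔ (λ x≡y → contradiction x≡y (ℕ.<⇒≢ p)) (λ x≡y → contradiction x≡y (ℕ.<⇒≢ q))

  agree-≡ : x ≡ y → x′ ≡ y′ → OrderAgrees x y x′ y′
  agree-≡ p q = mk⇔ (λ x<y → contradiction p (ℕ.<⇒≢ x<y)) (λ x<y → contradiction q (ℕ.<⇒≢ x<y))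
              , mk⇔ (const q) (const p)

  agree-> : y < x → y′ < x′ → OrderAgrees x y x′ y′
  agree-> p q = mk⇔ (λ x<y → contradiction p (ℕ.<-asym x<y)) (λ x<y → contradiction q (ℕ.<-asym x<y))
              , mk⇔ (λ x≡y → contradiction (sym x≡y) (ℕ.<⇒≢ p)) (λ x≡y → contradiction (sym x≡y) (ℕ.<⇒≢ q))

increasing₃ : ∀ {m} {i j k : Fin m} → i Fin.< j → j Fin.< k → Increasing (i ∷ j ∷ k ∷ [])
increasing₃ i<j j<k 0F 1F _ = i<j
increasing₃ i<j j<k 0F 2F _ = ℕ.<-trans i<j j<k
increasing₃ i<j j<k 1F 2F _ = j<k
increasing₃ i<j j<k 1F 1F (s≤s ())
increasing₃ i<j j<k 2F 1F (s≤s ())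
increasing₃ i<j j<k 2F 2F (s≤s (s≤s ()))

-- The number of positions of e that carry the letter y.
occurrences : ∀ {m} → ℕ → Vec ℕ m → ℕ
occurrences y [] = 0
occurrences y (x ∷ e) with x ≟ y
... | yes _ = suc (occurrences y e)
... | no  _ = occurrences y e

-- Strictly increasing sequences of positions, as functions.
Ascending : ∀ {k m} → (Fin k → Fin m) → Set
Ascending p = ∀ i j → i Fin.< j → p i Fin.< p j

prepend-zero : ∀ {k m} → (Fin k → Fin m) → Fin (suc k) → Fin (suc m)
prepend-zero p zero    = zero
prepend-zero p (suc i) = suc (p i)

prepend-zero-ascending : ∀ {k m} (p : Fin k → Fin m) → Ascending p → Ascending (prepend-zero p)
prepend-zero-ascending p ascending zero    (suc j) _         = s≤s z≤n
prepend-zero-ascending p ascending (suc i) (suc j) (s≤s i<j) = s≤s (ascending i j i<j)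

occurrences⇒positions : ∀ {m} k y (e : Vec ℕ m) → k ≤ occurrences y e →
  ∃ λ (p : Fin k → Fin m) → Ascending p × (∀ i → lookup e (p i) ≡ y)
occurrences⇒positions zero    y e       k≤ = (λ ()) , (λ ()) , (λ ())
occurrences⇒positions (suc k) y (x ∷ e) k≤ with x ≟ y
... | yes x≡y with p , ascending , letters ← occurrences⇒positions k y e (ℕ.s≤s⁻¹ k≤) =
  prepend-zero p , prepend-zero-ascending p ascending , λ { zero → x≡y ; (suc i) → letters i }
... | no _ with p , ascending , letters ← occurrences⇒positions (suc k) y e k≤ =
  (λ i → suc (p i)) , (λ i j i<j → s≤s (ascending i j i<j)) , letters

predecessor : ∀ {m} (i : Fin (suc m)) → zero {m} Fin.< i → ∃[ j ] i ≡ suc j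
predecessor (suc j) _ = j , refl

positions⇒occurrences : ∀ {m} k y (e : Vec ℕ m) (p : Fin k → Fin m) →
  Ascending p → (∀ i → lookup e (p i) ≡ y) → k ≤ occurrences y e
positions⇒occurrences zero y e p increasing letters = z≤n
positions⇒occurrences (suc k) y [] p increasing letters with () ← p zero
positions⇒occurrences {suc m} (suc k) y (x ∷ e) p increasing letters = byFirst (p zero) refl
  where
  -- Positions r that miss the first letter are positions of e shifted by one.
  module Shift {l} (r : Fin l → Fin (suc m)) (positive : ∀ i → zero {m} Fin.< r i)
               (inc : Ascending r) (lets : ∀ i → lookup (x ∷ e) (r i) ≡ y) where
    r≡suc : ∀ i → r i ≡ suc (proj₁ (predecessor (r i) (positive i)))
    r≡suc i = proj₂ (predecessor (r i) (positive i))

    shifted : l ≤ occurrences y e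
    shifted = positions⇒occurrences l y e (λ i → proj₁ (predecessor (r i) (positive i)))
      (λ i j i<j → ℕ.s≤s⁻¹ (subst₂ Fin._<_ (r≡suc i) (r≡suc j) (inc i j i<j)))
      (λ i → trans (cong (lookup (x ∷ e)) (sym (r≡suc i))) (lets i))

  after-first : ∀ i → p zero Fin.< p (suc i)
  after-first i = increasing zero (suc i) (s≤s z≤n)

  byFirst : ∀ i → p zero ≡ i → suc k ≤ occurrences y (x ∷ e)
  byFirst zero p₀≡0 with x ≟ y
  ... | yes _ = s≤s (Shift.shifted (p ∘ suc) (λ i → subst (Fin._< p (suc i)) p₀≡0 (after-first i))
                      (λ i j i<j → increasing (suc i) (suc j) (s≤s i<j)) (letters ∘ suc))
  ... | no x≢y = contradiction (trans (cong (lookup (x ∷ e)) (sym p₀≡0)) (letters zero)) x≢y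
  byFirst (suc i) p₀≡1+i = ℕ.≤-trans
    (Shift.shifted p
      (λ { zero → positive₀ ; (suc j) → ℕ.<-trans positive₀ (after-first j) }) increasing letters)
    occurrences-∷
    where
    positive₀ : zero {m} Fin.< p zero
    positive₀ = subst (zero {m} Fin.<_) (sym p₀≡1+i) (s≤s z≤n)
    occurrences-∷ : occurrences y e ≤ occurrences y (x ∷ e)
    occurrences-∷ with x ≟ y
    ... | yes _ = ℕ.n≤1+n _
    ... | no  _ = ℕ.≤-refl

avoids-000⇔ : ∀ {m} (e : Vec ℕ m) → Avoids e τ₀₀₀ ⇔ (∀ y → occurrences y e ≤ 2)
avoids-000⇔ e = mk⇔ to from
  where
  to : Avoids e τ₀₀₀ → ∀ y → occurrences y e ≤ 2
  to avoids y with occurrences y e ≤? 2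
  ... | yes occ≤2 = occ≤2
  ... | no  occ≰2 with p , increasing , letters ← occurrences⇒positions 3 y e (ℕ.≰⇒> occ≰2) =
    contradiction
      ( p 0F ∷ p 1F ∷ p 2F ∷ []
      , increasing₃ (increasing 0F 1F (s≤s z≤n)) (increasing 1F 2F (s≤s (s≤s z≤n)))
      , λ i j → agree-≡ (trans (image i) (sym (image j))) (trans (zeros i) (sym (zeros j))) )
      avoids
    where
    image : ∀ i → lookup (Vec.map (lookup e) (p 0F ∷ p 1F ∷ p 2F ∷ [])) i ≡ y
    image 0F = letters 0F
    image 1F = letters 1F
    image 2F = letters 2F
    zeros : ∀ i → lookup (Vec.fromList τ₀₀₀) i ≡ 0
    zeros 0F = refl
    zeros 1F = refl
    zeros 2F = refl
  from : (∀ y → occurrences y e ≤ 2) → Avoids e τ₀₀₀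
  from occ≤2 (i ∷ j ∷ k ∷ [] , increasing , iso) = contradiction
    (positions⇒occurrences 3 (lookup e i) e (lookup (i ∷ j ∷ k ∷ [])) increasing
      (λ { 0F → refl
         ; 1F → Equivalence.from (proj₂ (iso 1F 0F)) refl
         ; 2F → Equivalence.from (proj₂ (iso 2F 0F)) refl }))
    (ℕ.≤⇒≯ (occ≤2 (lookup e i)))

-- Each nonzero letter is at least as large as all letters before it; zeros may
-- stand anywhere.
NonzeroIncreasing : ∀ {m} → Vec ℕ m → Set
NonzeroIncreasing e = ∀ i j → i Fin.< j → 0 < lookup e j → lookup e i ≤ lookup e j

avoids-021⇔ : ∀ {m} (e : Vec ℕ (suc m)) → lookup e zero ≡ 0 → Avoids e τ₀₂₁ ⇔ NonzeroIncreasing e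
avoids-021⇔ {m} e e₀≡0 = mk⇔ to from
  where
  to : Avoids e τ₀₂₁ → NonzeroIncreasing e
  -- A violation e i > e j > 0 together with the initial zero is an occurrence of 021.
  to avoids i j i<j 0<eⱼ with lookup e i ≤? lookup e j
  ... | yes eᵢ≤eⱼ = eᵢ≤eⱼ
  ... | no  eᵢ≰eⱼ = contradiction
    (zero ∷ i ∷ j ∷ [] , increasing₃ 0<i i<j , iso) avoids
    where
    eⱼ<eᵢ = ℕ.≰⇒> eᵢ≰eⱼ
    e₀<eⱼ : lookup e zero < lookup e j
    e₀<eⱼ = subst (_< lookup e j) (sym e₀≡0) 0<eⱼ
    e₀<eᵢ = ℕ.<-trans e₀<eⱼ eⱼ<eᵢ
    0<i : zero {m} Fin.< i
    0<i = Fin.≤∧≢⇒< {i = zero} z≤n λ { refl → ℕ.<-irrefl refl e₀<eᵢ }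
    iso : OrderIsomorphic (lookup e zero ∷ lookup e i ∷ lookup e j ∷ []) (0 ∷ 2 ∷ 1 ∷ [])
    iso 0F 0F = agree-≡ refl refl
    iso 0F 1F = agree-< e₀<eᵢ (s≤s z≤n)
    iso 0F 2F = agree-< e₀<eⱼ (s≤s z≤n)
    iso 1F 0F = agree-> e₀<eᵢ (s≤s z≤n)
    iso 1F 1F = agree-≡ refl refl
    iso 1F 2F = agree-> eⱼ<eᵢ (s≤s (s≤s z≤n))
    iso 2F 0F = agree-> e₀<eⱼ (s≤s z≤n)
    iso 2F 1F = agree-< eⱼ<eᵢ (s≤s (s≤s z≤n))
    iso 2F 2F = agree-≡ refl refl
  from : NonzeroIncreasing e → Avoids e τ₀₂₁
  from mono (i ∷ j ∷ k ∷ [] , increasing , iso) =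
    ℕ.<⇒≱ (Equivalence.from (proj₁ (iso 2F 1F)) (s≤s (s≤s z≤n)))
      (mono j k (increasing 1F 2F (s≤s (s≤s z≤n)))
        (ℕ.≤-<-trans z≤n (Equivalence.from (proj₁ (iso 0F 2F)) (s≤s z≤n))))

-- Reading a sequence from left to right

-- The function cap says how often each letter may still be used; spend x cap is
-- what remains after one use of x.
spend : ℕ → (ℕ → ℕ) → ℕ → ℕ
spend x cap y with x ≟ y
... | yes _ = pred (cap y)
... | no  _ = cap y

-- The letter x may follow a prefix whose largest letter is v.
Allowed : (ℕ → ℕ) → ℕ → ℕ → Set
Allowed cap v x = 0 < cap x × (0 < x → v ≤ x)

-- Every letter of e may be appended in turn to a prefix with largest letter v.
Accepted : ∀ {m} → (ℕ → ℕ) → ℕ → Vec ℕ m → Set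
Accepted cap v []      = ⊤
Accepted cap v (x ∷ e) = Allowed cap v x × Accepted (spend x cap) (v ⊔ x) e

allowed? : ∀ cap v x → Dec (Allowed cap v x)
allowed? cap v x = (0 <? cap x) ×-dec ((0 <? x) →-dec (v ≤? x))

accepted? : ∀ {m} cap v → Decidable (Accepted {m} cap v)
accepted? cap v []      = yes tt
accepted? cap v (x ∷ e) = allowed? cap v x ×-dec accepted? (spend x cap) (v ⊔ x) e

occurrences-∷-≤ : ∀ {m} cap x (e : Vec ℕ m) →
  (∀ y → occurrences y (x ∷ e) ≤ cap y) ⇔ (0 < cap x × (∀ y → occurrences y e ≤ spend x cap y))
occurrences-∷-≤ cap x e = mk⇔ (λ occ≤ → positive (occ≤ x) , λ y → remaining y (occ≤ y))
                              (λ (0<cap , occ≤) y → total 0<cap y (occ≤ y))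
  where
  positive : occurrences x (x ∷ e) ≤ cap x → 0 < cap x
  positive occ≤ with x ≟ x
  ... | yes _   = ℕ.≤-trans (s≤s z≤n) occ≤
  ... | no  x≢x = contradiction refl x≢x
  remaining : ∀ y → occurrences y (x ∷ e) ≤ cap y → occurrences y e ≤ spend x cap y
  remaining y occ≤ with x ≟ y
  ... | yes _ = ℕ.pred-mono-≤ occ≤
  ... | no  _ = occ≤
  total : 0 < cap x → ∀ y → occurrences y e ≤ spend x cap y → occurrences y (x ∷ e) ≤ cap y
  total 0<cap y occ≤ with x ≟ y
  ... | no  _    = occ≤
  ... | yes refl with suc c ← cap x | s≤s _ ← 0<cap = s≤s occ≤

-- Acceptance means bounded multiplicities, weakly increasing nonzero letters, and
-- nonzero letters not below v.
accepted⇔ : ∀ {m} cap v (e : Vec ℕ m) → Accepted cap v e ⇔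
  ((∀ y → occurrences y e ≤ cap y) × NonzeroIncreasing e × (∀ i → 0 < lookup e i → v ≤ lookup e i))
accepted⇔ cap v [] = mk⇔ (λ _ → (λ y → z≤n) , (λ ()) , (λ ())) (λ _ → tt)
accepted⇔ cap v (x ∷ e) = mk⇔ to from
  where
  IH = accepted⇔ (spend x cap) (v ⊔ x) e
  to : Accepted cap v (x ∷ e) → _
  to ((0<cap , v≤x) , accepted) with occ≤ , mono , v⊔x≤ ← Equivalence.to IH accepted =
      Equivalence.from (occurrences-∷-≤ cap x e) (0<cap , occ≤)
    , (λ { zero (suc j) _ 0<eⱼ → ℕ.m⊔n≤o⇒n≤o v x (v⊔x≤ j 0<eⱼ)
         ; (suc i) (suc j) (s≤s i<j) → mono i j i<j })
    , (λ { zero → v≤x ; (suc i) 0<eᵢ → ℕ.m⊔n≤o⇒m≤o v x (v⊔x≤ i 0<eᵢ) })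
  from : _ → Accepted cap v (x ∷ e)
  from (occ≤ , mono , v≤) with 0<cap , occ≤′ ← Equivalence.to (occurrences-∷-≤ cap x e) occ≤ =
      (0<cap , v≤ zero)
    , Equivalence.from IH
        ( occ≤′
        , (λ i j i<j → mono (suc i) (suc j) (s≤s i<j))
        , (λ i 0<eᵢ → ℕ.⊔-lub (v≤ (suc i) 0<eᵢ) (mono zero (suc i) (s≤s z≤n) 0<eᵢ)) )

-- Counting accepted sequences

-- g at the predecessor of a positive number, and 0 if there is none.
fromStock : ℕ → (ℕ → ℕ) → ℕ
fromStock zero    g = 0
fromStock (suc q) g = g q

-- g d + … + g 1
downSum : (ℕ → ℕ) → ℕ → ℕ
downSum g zero    = 0
downSum g (suc d) = g (suc d) + downSum g d

-- The number of ways to append m letters when the next letter may exceed the largest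
-- one so far by at most d, and p copies of the latter and q zeros are left.
completions : (m d p q : ℕ) → ℕ
completions zero    d p q = 1
completions (suc m) d p q =
  fromStock q (completions m (suc d) p)
  + (fromStock p (λ p′ → completions m (suc d) p′ q)
     + downSum (λ k → completions m k 1 q) d)

filter-cong-∈ : ∀ {A : Set} {P Q : A → Set} (P? : Decidable P) (Q? : Decidable Q) xs →
  (∀ {x} → x ∈ xs → P x ⇔ Q x) → filter P? xs ≡ filter Q? xs
filter-cong-∈ P? Q? []       P⇔Q = refl
filter-cong-∈ P? Q? (x ∷ xs) P⇔Q with P? x
... | yes px = trans (cong (x ∷_) (filter-cong-∈ P? Q? xs (P⇔Q ∘ there)))
                     (sym (List.filter-accept Q? (Equivalence.to (P⇔Q (here refl)) px)))
... | no ¬px = trans (filter-cong-∈ P? Q? xs (P⇔Q ∘ there))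
                     (sym (List.filter-reject Q? (¬px ∘ Equivalence.from (P⇔Q (here refl)))))

length-filter-map : ∀ {A B : Set} {P : B → Set} (P? : Decidable P) (f : A → B) xs →
  length (filter P? (map f xs)) ≡ length (filter (P? ∘ f) xs)
length-filter-map P? f [] = refl
length-filter-map P? f (x ∷ xs) with P? (f x)
... | yes _ = cong suc (length-filter-map P? f xs)
... | no  _ = length-filter-map P? f xs

length-filter-product : ∀ {A B C : Set} {P : C → Set} (P? : Decidable P) (f : A → B → C) xs ys →
  length (filter P? (cartesianProductWith f xs ys)) ≡ sum (map (λ x → length (filter (P? ∘ f x) ys)) xs)
length-filter-product P? f []       ys = refl
length-filter-product P? f (x ∷ xs) ys = begin
  length (filter P? (map (f x) ys ++ cartesianProductWith f xs ys))
    ≡⟨ cong length (List.filter-++ P? (map (f x) ys) _) ⟩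
  length (filter P? (map (f x) ys) ++ filter P? (cartesianProductWith f xs ys))
    ≡⟨ List.length-++ (filter P? (map (f x) ys)) ⟩
  length (filter P? (map (f x) ys)) + length (filter P? (cartesianProductWith f xs ys))
    ≡⟨ cong₂ _+_ (length-filter-map P? (f x) ys) (length-filter-product P? f xs ys) ⟩
  length (filter (P? ∘ f x) ys) + sum (map (λ x → length (filter (P? ∘ f x) ys)) xs) ∎
  where open ≡-Reasoning

sum-applyUpTo-+ : ∀ g m n →
  sum (applyUpTo g (m + n)) ≡ sum (applyUpTo g m) + sum (applyUpTo (λ k → g (m + k)) n)
sum-applyUpTo-+ g zero    n = refl
sum-applyUpTo-+ g (suc m) n =
  trans (cong (λ r → g 0 + r) (sum-applyUpTo-+ (g ∘ suc) m n)) (sym (ℕ.+-assoc (g 0) _ _))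

sum-applyUpTo-zero : ∀ g n → (∀ k → k < n → g k ≡ 0) → sum (applyUpTo g n) ≡ 0
sum-applyUpTo-zero g zero    g≡0 = refl
sum-applyUpTo-zero g (suc n) g≡0 =
  cong₂ _+_ (g≡0 0 (s≤s z≤n)) (sum-applyUpTo-zero (g ∘ suc) n (λ k k<n → g≡0 (suc k) (s≤s k<n)))

-- Reversal of the order of summation.
sum-applyUpTo-downSum : ∀ h g d → (∀ k j → k + suc j ≡ d → h k ≡ g (suc j)) →
  sum (applyUpTo h d) ≡ downSum g d
sum-applyUpTo-downSum h g zero    h≡g = refl
sum-applyUpTo-downSum h g (suc d) h≡g =
  cong₂ _+_ (h≡g 0 d refl) (sum-applyUpTo-downSum (h ∘ suc) g d (λ k j eq → h≡g (suc k) j (cong suc eq)))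

-- What matters about cap after a prefix with largest letter v: q zeros and p further
-- copies of v are left, and two copies of every larger letter.  While v is 0, its
-- copies are accounted for by q alone, and p is 0.
record Stock (cap : ℕ → ℕ) (v p q : ℕ) : Set where
  field
    zeros    : cap 0 ≡ q
    current  : 0 < v → cap v ≡ p
    none     : v ≡ 0 → p ≡ 0
    unused   : ∀ y → v < y → cap y ≡ 2

spend-same : ∀ x cap → spend x cap x ≡ pred (cap x)
spend-same x cap with x ≟ x
... | yes _   = refl
... | no  x≢x = contradiction refl x≢x

spend-other : ∀ {x y} cap → x ≢ y → spend x cap y ≡ cap y
spend-other {x} {y} cap x≢y with x ≟ y
... | yes x≡y = contradiction x≡y x≢y
... | no  _   = refl

module _ {cap v p q} (stock : Stock cap v p q) where
  open Stock stock

  stock-zero : ∀ {q′} → q ≡ suc q′ → Stock (spend 0 cap) v p q′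
  stock-zero refl = record
    { zeros   = trans (spend-same 0 cap) (cong pred zeros)
    ; current = λ 0<v → trans (spend-other cap (ℕ.<⇒≢ 0<v)) (current 0<v)
    ; none    = none
    ; unused  = λ y v<y → trans (spend-other cap (ℕ.<⇒≢ (ℕ.≤-<-trans z≤n v<y))) (unused y v<y)
    }

  stock-repeat : ∀ {p′} → 0 < v → p ≡ suc p′ → Stock (spend v cap) v p′ q
  stock-repeat 0<v refl = record
    { zeros   = trans (spend-other cap (≢-sym (ℕ.<⇒≢ 0<v))) zeros
    ; current = λ _ → trans (spend-same v cap) (cong pred (current 0<v))
    ; none    = λ v≡0 → contradiction (sym v≡0) (ℕ.<⇒≢ 0<v)
    ; unused  = λ y v<y → trans (spend-other cap (ℕ.<⇒≢ v<y)) (unused y v<y)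
    }

  stock-new : ∀ {x} → v < x → Stock (spend x cap) x 1 q
  stock-new {x} v<x = record
    { zeros   = trans (spend-other cap (≢-sym (ℕ.<⇒≢ (ℕ.≤-<-trans z≤n v<x)))) zeros
    ; current = λ _ → trans (spend-same x cap) (cong pred (unused x v<x))
    ; none    = λ { refl → contradiction v<x λ () }
    ; unused  = λ y x<y → trans (spend-other cap (ℕ.<⇒≢ x<y)) (unused y (ℕ.<-trans v<x x<y))
    }

-- The number of accepted sequences whose k-th letter, counted from 0, is at most
-- v + d + k.
length-accepted : ∀ m {cap v p q} d (b : Fin m → ℕ) → Stock cap v p q → (∀ k → b k ≡ v + d + toℕ k) →
  length (filter (accepted? cap v) (box b)) ≡ completions m d p q
length-accepted zero    d b stock b≡ = refl
length-accepted (suc m) {cap} {v} {p} {q} d b stock b≡ = begin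
  length (filter (accepted? cap v) (box b))
    ≡⟨ length-filter-product (accepted? cap v) _∷_ (upTo (suc (b zero))) (box (b ∘ suc)) ⟩
  sum (map starting (upTo (suc (b zero))))
    ≡⟨ cong sum (List.map-upTo starting (suc (b zero))) ⟩
  sum (applyUpTo starting (suc (b zero)))
    ≡⟨ cong (sum ∘ applyUpTo starting ∘ suc) (trans (b≡ zero) (ℕ.+-identityʳ (v + d))) ⟩
  starting 0 + sum (applyUpTo (starting ∘ suc) (v + d))
    ≡⟨ cong₂ _+_ (starting-zero q refl) (starting-nonzero v refl) ⟩
  completions (suc m) d p q ∎
  where
  open ≡-Reasoning
  open Stock stock

  -- The number of accepted sequences with first letter x.
  starting : ℕ → ℕ
  starting x = length (filter (accepted? cap v ∘ (x ∷_)) (box (b ∘ suc)))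

  rejected : ∀ {x} → ¬ Allowed cap v x → starting x ≡ 0
  rejected {x} ¬allowed = trans
    (cong length (filter-cong-∈ (accepted? cap v ∘ (x ∷_)) (λ _ → no (λ ())) (box (b ∘ suc))
      (λ _ → mk⇔ (¬allowed ∘ proj₁) ⊥-elim)))
    (none-accepted (box (b ∘ suc)))
    where
    none-accepted : ∀ {A : Set} (xs : List A) → length (filter (λ _ → no (λ ())) xs) ≡ 0
    none-accepted []       = refl
    none-accepted (x ∷ xs) = none-accepted xs

  -- After x the largest letter is w, and the next bound v + d + 1 is w + d′.
  accepting : ∀ {x w d′ p′ q′} → Allowed cap v x → v ⊔ x ≡ w → Stock (spend x cap) w p′ q′ →
    w + d′ ≡ suc (v + d) → starting x ≡ completions m d′ p′ q′
  accepting {x} {d′ = d′} allowed refl stock′ total = trans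
    (cong length (List.filter-≐ (accepted? cap v ∘ (x ∷_)) (accepted? (spend x cap) (v ⊔ x))
      (proj₂ , (allowed ,_)) (box (b ∘ suc))))
    (length-accepted m d′ (b ∘ suc) stock′ λ k →
      trans (b≡ (suc k)) (trans (ℕ.+-suc (v + d) (toℕ k)) (cong (_+ toℕ k) (sym total))))

  starting-zero : ∀ r → q ≡ r → starting 0 ≡ fromStock r (completions m (suc d) p)
  starting-zero zero     q≡ = rejected λ (0<cap , _) → ℕ.<⇒≢ 0<cap (sym (trans zeros q≡))
  starting-zero (suc q′) q≡ = accepting
    (subst (0 <_) (sym (trans zeros q≡)) (s≤s z≤n) , λ ())
    (ℕ.⊔-identityʳ v) (stock-zero stock q≡) (ℕ.+-suc v d)

  starting-repeat : 0 < v → ∀ r → p ≡ r → starting v ≡ fromStock r (λ p′ → completions m (suc d) p′ q)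
  starting-repeat 0<v zero     p≡ = rejected λ (0<cap , _) →
    ℕ.<⇒≢ 0<cap (sym (trans (current 0<v) p≡))
  starting-repeat 0<v (suc p′) p≡ = accepting
    (subst (0 <_) (sym (trans (current 0<v) p≡)) (s≤s z≤n) , λ _ → ℕ.≤-refl)
    (ℕ.⊔-idem v) (stock-repeat stock 0<v p≡) (ℕ.+-suc v d)

  starting-new : ∀ {x} k j → x ≡ suc (v + k) → k + suc j ≡ d → starting x ≡ completions m (suc j) 1 q
  starting-new {x} k j refl refl = accepting
    (subst (0 <_) (sym (unused x v<x)) (s≤s z≤n) , λ _ → ℕ.<⇒≤ v<x)
    (ℕ.m≤n⇒m⊔n≡n (ℕ.<⇒≤ v<x)) (stock-new stock v<x)
    (cong suc (ℕ.+-assoc v k (suc j)))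
    where
    v<x = s≤s (ℕ.m≤m+n v k)

  -- For v > 0 the letters 1, …, v - 1 contribute nothing, v is a repetition and
  -- v + 1, …, v + d are new; for v = 0 all of 1, …, d are new.
  starting-nonzero : ∀ w → w ≡ v → sum (applyUpTo (starting ∘ suc) (w + d)) ≡
    fromStock p (λ p′ → completions m (suc d) p′ q) + downSum (λ k → completions m k 1 q) d
  starting-nonzero zero 0≡v = trans
    (sum-applyUpTo-downSum (starting ∘ suc) (λ k → completions m k 1 q) d
      (λ k j → starting-new k j (cong (λ u → suc (u + k)) 0≡v)))
    (cong (λ r → fromStock r (λ p′ → completions m (suc d) p′ q)
                 + downSum (λ k → completions m k 1 q) d)
          (sym (none (sym 0≡v))))
  starting-nonzero (suc w) refl = begin
    sum (applyUpTo (starting ∘ suc) (suc w + d))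
      ≡⟨ cong (sum ∘ applyUpTo (starting ∘ suc)) (ℕ.+-suc w d) ⟨
    sum (applyUpTo (starting ∘ suc) (w + suc d))
      ≡⟨ sum-applyUpTo-+ (starting ∘ suc) w (suc d) ⟩
    sum (applyUpTo (starting ∘ suc) w)
      + (starting (suc (w + 0)) + sum (applyUpTo (λ k → starting (suc (w + suc k))) d))
      ≡⟨ cong₂ _+_
           (sum-applyUpTo-zero (starting ∘ suc) w λ k k<w →
             rejected λ (_ , v≤x) → ℕ.<⇒≱ (s≤s k<w) (v≤x (s≤s z≤n)))
           (cong₂ _+_
             (trans (cong (starting ∘ suc) (ℕ.+-identityʳ w)) (starting-repeat (s≤s z≤n) p refl))
             (sum-applyUpTo-downSum _ (λ k → completions m k 1 q) d λ k j →
               starting-new k j (cong suc (ℕ.+-suc w k)))) ⟩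
    fromStock p (λ p′ → completions m (suc d) p′ q) + downSum (λ k → completions m k 1 q) d ∎

∣I∣-completions : ∀ n → ∣I∣ n (τ₀₀₀ ∷ τ₀₂₁ ∷ []) ≡ completions (suc n) 0 0 2
∣I∣-completions n = trans
  (cong length same-elements)
  (length-accepted (suc n) {const 2} {0} 0 toℕ
    (record { zeros = refl ; current = λ () ; none = λ _ → refl ; unused = λ _ _ → refl })
    (λ _ → refl))
  where
  equivalent : ∀ e → IsInversionSequence e → All (Avoids e) (τ₀₀₀ ∷ τ₀₂₁ ∷ []) ⇔ Accepted (const 2) 0 e
  equivalent e e≤ = mk⇔
    (λ { (no000 ∷ no021 ∷ []) → Equivalence.from acc
           (Equivalence.to (avoids-000⇔ e) no000 , Equivalence.to av021 no021 , λ _ _ → z≤n) })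
    (λ accepted → let occ≤2 , mono , _ = Equivalence.to acc accepted in
       Equivalence.from (avoids-000⇔ e) occ≤2 ∷ Equivalence.from av021 mono ∷ [])
    where
    acc = accepted⇔ (const 2) 0 e
    av021 = avoids-021⇔ e (ℕ.n≤0⇒n≡0 (e≤ zero))

  same-elements : Enumeration.elements (enumerate n (τ₀₀₀ ∷ τ₀₂₁ ∷ [])) ≡
                  filter (accepted? (const 2) 0) (box {suc n} toℕ)
  same-elements = filter-cong-∈ _ (accepted? (const 2) 0) (box {suc n} toℕ)
    λ {e} e∈ → equivalent e (box-sound toℕ e∈)

-- The closed form of the number of completions

-- The coefficient of y^j, and of y^-j, in (y⁻¹ + 1 + y)^n.
trinomial : ℕ → ℕ → ℤ
trinomial zero    zero    = + 1
trinomial zero    (suc j) = + 0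
trinomial (suc n) zero    = trinomial n 0 ℤ.+ trinomial n 1 ℤ.+ trinomial n 1
trinomial (suc n) (suc j) = trinomial n j ℤ.+ trinomial n (1 + j) ℤ.+ trinomial n (2 + j)

trinomial-beyond : ∀ n j → n < j → trinomial n j ≡ + 0
trinomial-beyond zero    (suc j) n<j       = refl
trinomial-beyond (suc n) (suc j) (s≤s n<j)
  rewrite trinomial-beyond n j n<j
        | trinomial-beyond n (1 + j) (ℕ.m≤n⇒m≤1+n n<j)
        | trinomial-beyond n (2 + j) (ℕ.m≤n⇒m≤1+n (ℕ.m≤n⇒m≤1+n n<j)) = refl

trinomial-diagonal : ∀ n → trinomial n n ≡ + 1
trinomial-diagonal zero = refl
trinomial-diagonal (suc n)
  rewrite trinomial-diagonal n
        | trinomial-beyond n (1 + n) ℕ.≤-refl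
        | trinomial-beyond n (2 + n) (ℕ.n≤1+n _) = refl

-- An expression in d and in entries t 0, t 1, … of the trinomial triangle, to be
-- evaluated at the segment t j = T(s, d + j) of row s.
Formula : Set
Formula = ℤ → (ℕ → ℤ) → ℤ

_atLevel_from_ : Formula → ℕ → ℕ → ℤ
f atLevel s from d = f (+ d) (λ j → trinomial s (j + d))

-- The indices of a closed form are p and q.  The sum over all new largest letters is
-- given by sum₁ when q = 1; when q = 0 it is given by closed₀₀, since with p = q = 0
-- the next letter has to be a new largest one.
closed₀₀ closed₁₀ closed₀₁ closed₁₁ sum₁ : Formula
closed₀₀ d t = t 0 ℤ.- t 2
closed₁₀ d t = t 0 ℤ.+ t 1 ℤ.- t 2 ℤ.- t 3
closed₀₁ d t = t 0 ℤ.+ t 1 ℤ.+ t 3 ℤ.+ d ℤ.* (t 2 ℤ.+ + 2 ℤ.* t 3)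
closed₁₁ d t = t 0 ℤ.+ + 2 ℤ.* (t 1 ℤ.+ t 2 ℤ.+ t 3 ℤ.+ t 4)
               ℤ.+ d ℤ.* (t 2 ℤ.+ + 3 ℤ.* t 3 ℤ.+ + 2 ℤ.* t 4)
sum₁ d t = t 0 ℤ.+ + 2 ℤ.* t 3 ℤ.+ d ℤ.* (t 2 ℤ.+ + 2 ℤ.* t 3)

-- The formula f gives the number of completions at d + 1; the shift keeps the
-- indices of the trinomials nonnegative.  The level s is a variable of its own so
-- that different decompositions m + d can be used at the same level.
Solves : (m p q : ℕ) → Formula → Set
Solves m p q f = ∀ d s → m + d ≡ s → + completions m (suc d) p q ≡ f atLevel s from d

record ClosedForms (m : ℕ) : Set where
  field
    solves₀₀ : Solves m 0 0 closed₀₀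
    solves₁₀ : Solves m 1 0 closed₁₀
    solves₀₁ : Solves m 0 1 closed₀₁
    solves₁₁ : Solves m 1 1 closed₁₁

module _ {m : ℕ} (forms : ClosedForms m) where
  open ClosedForms forms

  -- Both sums telescope: by the recurrence of the trinomials, each summand is the
  -- difference of consecutive values of the right-hand side.
  downSum-closed₀ : ∀ d s → suc (m + d) ≡ s →
    + downSum (λ k → completions m k 1 0) (suc d) ≡ closed₀₀ atLevel s from d
  downSum-closed₀ zero s refl =
    trans (cong (λ c → c ℤ.+ + 0) (solves₁₀ 0 _ refl))
          (lemma (t 0) (t 1) (t 2) (t 3))
    where
    t = trinomial (m + 0)
    lemma : ∀ x₀ x₁ x₂ x₃ → (x₀ ℤ.+ x₁ ℤ.- x₂ ℤ.- x₃) ℤ.+ + 0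
                           ≡ (x₀ ℤ.+ x₁ ℤ.+ x₁) ℤ.- (x₁ ℤ.+ x₂ ℤ.+ x₃)
    lemma = ℤ-Ring.solve-∀
  downSum-closed₀ (suc d) s refl =
    trans (cong₂ ℤ._+_ (solves₁₀ (suc d) _ refl) (downSum-closed₀ d _ (sym (ℕ.+-suc m d))))
          (lemma (t 0) (t 1) (t 2) (t 3) (t 4))
    where
    t = λ j → trinomial (m + suc d) (j + d)
    lemma : ∀ x₀ x₁ x₂ x₃ x₄ → (x₁ ℤ.+ x₂ ℤ.- x₃ ℤ.- x₄) ℤ.+ (x₀ ℤ.- x₂)
      ≡ (x₀ ℤ.+ x₁ ℤ.+ x₂) ℤ.- (x₂ ℤ.+ x₃ ℤ.+ x₄)
    lemma = ℤ-Ring.solve-∀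

  downSum-closed₁ : ∀ d s → suc (m + d) ≡ s →
    + downSum (λ k → completions m k 1 1) (suc d) ≡ sum₁ atLevel s from d
  downSum-closed₁ zero s refl =
    trans (cong (λ c → c ℤ.+ + 0) (solves₁₁ 0 _ refl))
          (lemma (t 0) (t 1) (t 2) (t 3) (t 4))
    where
    t = trinomial (m + 0)
    lemma : ∀ x₀ x₁ x₂ x₃ x₄ →
      x₀ ℤ.+ + 2 ℤ.* (x₁ ℤ.+ x₂ ℤ.+ x₃ ℤ.+ x₄)
        ℤ.+ + 0 ℤ.* (x₂ ℤ.+ + 3 ℤ.* x₃ ℤ.+ + 2 ℤ.* x₄) ℤ.+ + 0
      ≡ (x₀ ℤ.+ x₁ ℤ.+ x₁) ℤ.+ + 2 ℤ.* (x₂ ℤ.+ x₃ ℤ.+ x₄)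
        ℤ.+ + 0 ℤ.* ((x₁ ℤ.+ x₂ ℤ.+ x₃) ℤ.+ + 2 ℤ.* (x₂ ℤ.+ x₃ ℤ.+ x₄))
    lemma = ℤ-Ring.solve-∀
  downSum-closed₁ (suc d) s refl =
    trans (cong₂ ℤ._+_ (solves₁₁ (suc d) _ refl) (downSum-closed₁ d _ (sym (ℕ.+-suc m d))))
          (lemma (+ d) (t 0) (t 1) (t 2) (t 3) (t 4) (t 5))
    where
    t = λ j → trinomial (m + suc d) (j + d)
    lemma : ∀ e x₀ x₁ x₂ x₃ x₄ x₅ →
      x₁ ℤ.+ + 2 ℤ.* (x₂ ℤ.+ x₃ ℤ.+ x₄ ℤ.+ x₅)
        ℤ.+ (+ 1 ℤ.+ e) ℤ.* (x₃ ℤ.+ + 3 ℤ.* x₄ ℤ.+ + 2 ℤ.* x₅)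
      ℤ.+ (x₀ ℤ.+ + 2 ℤ.* x₃ ℤ.+ e ℤ.* (x₂ ℤ.+ + 2 ℤ.* x₃))
      ≡ (x₀ ℤ.+ x₁ ℤ.+ x₂) ℤ.+ + 2 ℤ.* (x₃ ℤ.+ x₄ ℤ.+ x₅)
        ℤ.+ (+ 1 ℤ.+ e) ℤ.* ((x₂ ℤ.+ x₃ ℤ.+ x₄) ℤ.+ + 2 ℤ.* (x₃ ℤ.+ x₄ ℤ.+ x₅))
    lemma = ℤ-Ring.solve-∀

closedForms : ∀ m → ClosedForms m
closedForms zero = record
  { solves₀₀ = λ { d _ refl → base d (λ x₀ x₁ x₂ x₃ x₄ → x₀ ℤ.- x₂) refl }
  ; solves₁₀ = λ { d _ refl → base d (λ x₀ x₁ x₂ x₃ x₄ → x₀ ℤ.+ x₁ ℤ.- x₂ ℤ.- x₃) refl }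
  ; solves₀₁ = λ { d _ refl → base d (λ x₀ x₁ x₂ x₃ x₄ →
      x₀ ℤ.+ x₁ ℤ.+ x₃ ℤ.+ + d ℤ.* (x₂ ℤ.+ + 2 ℤ.* x₃)) (cong ℤ.suc (sym (ℤ.*-zeroʳ (+ d)))) }
  ; solves₁₁ = λ { d _ refl → base d (λ x₀ x₁ x₂ x₃ x₄ →
      x₀ ℤ.+ + 2 ℤ.* (x₁ ℤ.+ x₂ ℤ.+ x₃ ℤ.+ x₄)
      ℤ.+ + d ℤ.* (x₂ ℤ.+ + 3 ℤ.* x₃ ℤ.+ + 2 ℤ.* x₄)) (cong ℤ.suc (sym (ℤ.*-zeroʳ (+ d)))) }
  }
  where
  -- In row d of the triangle the segment from d on is 1, 0, 0, ….
  base : ∀ d (f : (x₀ x₁ x₂ x₃ x₄ : ℤ) → ℤ) → + 1 ≡ f (+ 1) (+ 0) (+ 0) (+ 0) (+ 0) →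
    let t = λ j → trinomial d (j + d) in + 1 ≡ f (t 0) (t 1) (t 2) (t 3) (t 4)
  base d f eq
    rewrite trinomial-diagonal d
          | trinomial-beyond d (1 + d) (ℕ.m≤n+m (suc d) 0)
          | trinomial-beyond d (2 + d) (ℕ.m≤n+m (suc d) 1)
          | trinomial-beyond d (3 + d) (ℕ.m≤n+m (suc d) 2)
          | trinomial-beyond d (4 + d) (ℕ.m≤n+m (suc d) 3) = eq
closedForms (suc m) = record
  { solves₀₀ = λ { d _ refl → downSum-closed₀ ih d _ refl }
  ; solves₁₀ = λ { d _ refl →
      trans (cong₂ ℤ._+_ (solves₀₀ (suc d) _ (ℕ.+-suc m d)) (downSum-closed₀ ih d _ refl))
            (lemma₁₀ (t d 0) (t d 1) (t d 2) (t d 3)) }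
  ; solves₀₁ = λ { d _ refl →
      trans (cong₂ ℤ._+_ (solves₀₀ (suc d) _ (ℕ.+-suc m d)) (downSum-closed₁ ih d _ refl))
            (lemma₀₁ (+ d) (t d 0) (t d 1) (t d 2) (t d 3)) }
  ; solves₁₁ = λ { d _ refl →
      trans (cong₂ ℤ._+_ (solves₁₀ (suc d) _ (ℕ.+-suc m d))
              (cong₂ ℤ._+_ (solves₀₁ (suc d) _ (ℕ.+-suc m d)) (downSum-closed₁ ih d _ refl)))
            (lemma₁₁ (+ d) (t d 0) (t d 1) (t d 2) (t d 3) (t d 4)) }
  }
  where
  ih = closedForms m
  open ClosedForms ih
  t = λ d j → trinomial (suc (m + d)) (j + d)
  lemma₁₀ : ∀ x₀ x₁ x₂ x₃ → (x₁ ℤ.- x₃) ℤ.+ (x₀ ℤ.- x₂) ≡ x₀ ℤ.+ x₁ ℤ.- x₂ ℤ.- x₃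
  lemma₁₀ = ℤ-Ring.solve-∀
  lemma₀₁ : ∀ e x₀ x₁ x₂ x₃ →
    (x₁ ℤ.- x₃) ℤ.+ (x₀ ℤ.+ + 2 ℤ.* x₃ ℤ.+ e ℤ.* (x₂ ℤ.+ + 2 ℤ.* x₃))
    ≡ x₀ ℤ.+ x₁ ℤ.+ x₃ ℤ.+ e ℤ.* (x₂ ℤ.+ + 2 ℤ.* x₃)
  lemma₀₁ = ℤ-Ring.solve-∀
  lemma₁₁ : ∀ e x₀ x₁ x₂ x₃ x₄ →
    (x₁ ℤ.+ x₂ ℤ.- x₃ ℤ.- x₄)
      ℤ.+ ((x₁ ℤ.+ x₂ ℤ.+ x₄ ℤ.+ (+ 1 ℤ.+ e) ℤ.* (x₃ ℤ.+ + 2 ℤ.* x₄))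
           ℤ.+ (x₀ ℤ.+ + 2 ℤ.* x₃ ℤ.+ e ℤ.* (x₂ ℤ.+ + 2 ℤ.* x₃)))
    ≡ x₀ ℤ.+ + 2 ℤ.* (x₁ ℤ.+ x₂ ℤ.+ x₃ ℤ.+ x₄)
      ℤ.+ e ℤ.* (x₂ ℤ.+ + 3 ℤ.* x₃ ℤ.+ + 2 ℤ.* x₄)
  lemma₁₁ = ℤ-Ring.solve-∀

-- The first letter is forced to be a zero, which leaves the state with d = 1, p = 0
-- and q = 1.
completions-trinomial : ∀ n →
  + completions (suc n) 0 0 2 ≡ trinomial n 0 ℤ.+ trinomial n 1 ℤ.+ trinomial n 3
completions-trinomial n =
  trans (cong +_ (ℕ.+-identityʳ _))
  (trans (ClosedForms.solves₀₁ (closedForms n) 0 n (ℕ.+-identityʳ n))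
         (lemma (t 0) (t 1) (t 2) (t 3)))
  where
  t = trinomial n
  lemma : ∀ x₀ x₁ x₂ x₃ →
    x₀ ℤ.+ x₁ ℤ.+ x₃ ℤ.+ + 0 ℤ.* (x₂ ℤ.+ + 2 ℤ.* x₃) ≡ x₀ ℤ.+ x₁ ℤ.+ x₃
  lemma = ℤ-Ring.solve-∀

-- Central trinomial coefficients

-- For k > n the truncated exponent is harmless, because the binomial coefficient
-- vanishes.
signedBinomial : ℕ → ℕ → ℤ
signedBinomial n k = -1ℤ ℤ.^ (n ∸ k) ℤ.* + (n C k)

-- The n-th finite difference at 0, ∑ (-1)^(n-k) C(n, k) f(k).
difference : ℕ → (ℕ → ℤ) → ℤ
difference n f = sumℤ λ (k : Fin (suc n)) → signedBinomial n (toℕ k) ℤ.* f (toℕ k)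

signedBinomial-beyond : ∀ {n k} → n < k → signedBinomial n k ≡ + 0
signedBinomial-beyond {n} {k} n<k =
  trans (cong (λ c → -1ℤ ℤ.^ (n ∸ k) ℤ.* + c) (k>n⇒nCk≡0 n<k)) (ℤ.*-zeroʳ (-1ℤ ℤ.^ (n ∸ k)))

signedBinomial-zero : ∀ n → signedBinomial (suc n) 0 ℤ.+ signedBinomial n 0 ≡ + 0
signedBinomial-zero n = lemma (-1ℤ ℤ.^ n)
  where
  lemma : ∀ s → -1ℤ ℤ.* s ℤ.* + 1 ℤ.+ s ℤ.* + 1 ≡ + 0
  lemma = ℤ-Ring.solve-∀

signedBinomial-suc : ∀ n k →
  signedBinomial (suc n) (suc k) ℤ.+ signedBinomial n (suc k) ≡ signedBinomial n k
signedBinomial-suc n k with ℕ.≤-total n k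
... | inj₁ n≤k = trans
  (cong₂ ℤ._+_ (cong (λ c → s ℤ.* + c) pascal) (signedBinomial-beyond {n} {suc k} (s≤s n≤k)))
  (ℤ.+-identityʳ _)
  where
  s = -1ℤ ℤ.^ (n ∸ k)
  pascal : suc n C suc k ≡ n C k
  pascal = trans (sym (nCk+nC[k+1]≡[n+1]C[k+1] n k))
           (trans (cong (n C k ℕ.+_) (k>n⇒nCk≡0 (s≤s n≤k))) (ℕ.+-identityʳ _))
... | inj₂ k≤n with ℕ.m≤n⇒m<n∨m≡n k≤n
...   | inj₂ refl = trans
  (cong₂ ℤ._+_ (cong (λ c → s ℤ.* + c) pascal) (signedBinomial-beyond {n} {suc n} ℕ.≤-refl))
  (ℤ.+-identityʳ _)
  where
  s = -1ℤ ℤ.^ (n ∸ k)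
  pascal : suc n C suc k ≡ n C k
  pascal = trans (nCn≡1 (suc n)) (sym (nCn≡1 n))
...   | inj₁ k<n = trans
  (cong (λ c → c ℤ.+ signedBinomial n (suc k))
    (cong₂ (λ e c → -1ℤ ℤ.^ e ℤ.* + c) exponents (sym (nCk+nC[k+1]≡[n+1]C[k+1] n k))))
  (trans (lemma (-1ℤ ℤ.^ (n ∸ suc k)) (+ (n C k)) (+ (n C suc k)))
         (cong (λ e → -1ℤ ℤ.^ e ℤ.* + (n C k)) (sym exponents)))
  where
  exponents : n ∸ k ≡ suc (n ∸ suc k)
  exponents = ℕ.+-∸-assoc 1 k<n
  lemma : ∀ s x y → -1ℤ ℤ.* s ℤ.* (x ℤ.+ y) ℤ.+ s ℤ.* y ≡ -1ℤ ℤ.* s ℤ.* x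
  lemma = ℤ-Ring.solve-∀

difference-cong : ∀ n {f g} → f ≗ g → difference n f ≡ difference n g
difference-cong n f≗g = sumℤ-cong λ (k : Fin (suc n)) → cong (signedBinomial n (toℕ k) ℤ.*_) (f≗g (toℕ k))

difference-+ : ∀ n f g → difference n (λ k → f k ℤ.+ g k) ≡ difference n f ℤ.+ difference n g
difference-+ n f g = trans
  (sumℤ-cong {suc n} (λ k → ℤ.*-distribˡ-+ (signedBinomial n (toℕ k)) (f (toℕ k)) (g (toℕ k))))
  (sumℤ-+ {suc n} (λ k → signedBinomial n (toℕ k) ℤ.* f (toℕ k))
                  (λ k → signedBinomial n (toℕ k) ℤ.* g (toℕ k)))

difference-sum₄ : ∀ n {e f g h i} → (∀ k → e k ≡ f k ℤ.+ (g k ℤ.+ (h k ℤ.+ i k))) →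
  difference n e ≡ difference n f ℤ.+ (difference n g ℤ.+ (difference n h ℤ.+ difference n i))
difference-sum₄ n {e} {f} {g} {h} {i} eq = begin
  difference n e ≡⟨ difference-cong n eq ⟩
  difference n (λ k → f k ℤ.+ (g k ℤ.+ (h k ℤ.+ i k)))
    ≡⟨ difference-+ n f (λ k → g k ℤ.+ (h k ℤ.+ i k)) ⟩
  difference n f ℤ.+ difference n (λ k → g k ℤ.+ (h k ℤ.+ i k))
    ≡⟨ cong (λ c → difference n f ℤ.+ c) (difference-+ n g (λ k → h k ℤ.+ i k)) ⟩
  difference n f ℤ.+ (difference n g ℤ.+ difference n (λ k → h k ℤ.+ i k))
    ≡⟨ cong (λ c → difference n f ℤ.+ (difference n g ℤ.+ c)) (difference-+ n h i) ⟩
  difference n f ℤ.+ (difference n g ℤ.+ (difference n h ℤ.+ difference n i)) ∎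
  where open ≡-Reasoning

-- The difference operator is the shift minus the identity.
difference-suc : ∀ n f → difference (suc n) f ℤ.+ difference n f ≡ difference n (f ∘ suc)
difference-suc n f = begin
  difference (suc n) f ℤ.+ difference n f
    -- The summand with k = n + 1 vanishes in the second sum.
    ≡⟨ cong (λ c → difference (suc n) f ℤ.+ c) widen ⟩
  sumℤ (term (suc n)) ℤ.+ sumℤ (term n)
    ≡⟨ sumℤ-+ (term (suc n)) (term n) ⟨
  sumℤ (λ k → term (suc n) k ℤ.+ term n k)
    ≡⟨ sumℤ-cong {suc (suc n)} (λ k → sym (ℤ.*-distribʳ-+ (f (toℕ k))
         (signedBinomial (suc n) (toℕ k)) (signedBinomial n (toℕ k)))) ⟩
  sumℤ (λ (k : Fin (suc (suc n))) →
    (signedBinomial (suc n) (toℕ k) ℤ.+ signedBinomial n (toℕ k)) ℤ.* f (toℕ k))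
    ≡⟨ cong₂ ℤ._+_ (cong (ℤ._* f 0) (signedBinomial-zero n))
         (sumℤ-cong {suc n} (λ k → cong (ℤ._* f (suc (toℕ k))) (signedBinomial-suc n (toℕ k)))) ⟩
  + 0 ℤ.+ difference n (f ∘ suc)
    ≡⟨ ℤ.+-identityˡ _ ⟩
  difference n (f ∘ suc) ∎
  where
  open ≡-Reasoning
  term : ℕ → Fin (suc (suc n)) → ℤ
  term m k = signedBinomial m (toℕ k) ℤ.* f (toℕ k)

  widen : difference n f ≡ sumℤ (term n)
  widen = sym (trans (sumℤ-init-last (term n)) (trans
    (cong₂ ℤ._+_
      (sumℤ-cong {suc n} (λ k → cong (λ i → signedBinomial n i ℤ.* f i) (Fin.toℕ-inject₁ k)))
      (cong (ℤ._* f (toℕ (fromℕ (suc n))))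
        (trans (cong (signedBinomial n) (Fin.toℕ-fromℕ (suc n)))
               (signedBinomial-beyond {n} {suc n} ℕ.≤-refl))))
    (ℤ.+-identityʳ _)))

-- The coefficient of y^j in (y^½ + y^-½)^(2k).
evenBinomial : ℕ → ℕ → ℤ
evenBinomial j k = + ((2 ℕ.* k) C (j + k))

pascal² : ∀ n k → suc (suc n) C suc (suc k) ≡ n C k + (n C suc k + (n C suc k + n C suc (suc k)))
pascal² n k = sym (begin
  n C k + (n C suc k + (n C suc k + n C suc (suc k)))  ≡⟨ ℕ.+-assoc (n C k) _ _ ⟨
  n C k + n C suc k + (n C suc k + n C suc (suc k))
    ≡⟨ cong₂ _+_ (nCk+nC[k+1]≡[n+1]C[k+1] n k) (nCk+nC[k+1]≡[n+1]C[k+1] n (suc k)) ⟩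
  suc n C suc k + suc n C suc (suc k)                  ≡⟨ nCk+nC[k+1]≡[n+1]C[k+1] (suc n) (suc k) ⟩
  suc (suc n) C suc (suc k)                            ∎)
  where open ≡-Reasoning

evenBinomial-suc : ∀ j k → evenBinomial (suc j) (suc k) ≡
  evenBinomial j k ℤ.+ (evenBinomial (1 + j) k ℤ.+ (evenBinomial (1 + j) k ℤ.+ evenBinomial (2 + j) k))
evenBinomial-suc j k = cong +_ (trans
  (cong₂ _C_ (ℕ.*-suc 2 k) (cong suc (ℕ.+-suc j k)))
  (pascal² (2 ℕ.* k) (j + k)))

-- The entry to the left of the centre is replaced by its mirror image.
evenBinomial-zero : ∀ k → evenBinomial 0 (suc k) ≡
  evenBinomial 0 k ℤ.+ (evenBinomial 1 k ℤ.+ (evenBinomial 0 k ℤ.+ evenBinomial 1 k))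
evenBinomial-zero k = cong +_ (begin
  (2 ℕ.* suc k) C suc k       ≡⟨ cong (_C suc k) (ℕ.*-suc 2 k) ⟩
  suc (suc n) C suc k         ≡⟨ nCk+nC[k+1]≡[n+1]C[k+1] (suc n) k ⟨
  suc n C k + suc n C suc k   ≡⟨ cong (_+ suc n C suc k) symmetric ⟩
  suc n C suc k + suc n C suc k
    ≡⟨ cong₂ _+_ (nCk+nC[k+1]≡[n+1]C[k+1] n k) (nCk+nC[k+1]≡[n+1]C[k+1] n k) ⟨
  n C k + n C suc k + (n C k + n C suc k) ≡⟨ ℕ.+-assoc (n C k) _ _ ⟩
  n C k + (n C suc k + (n C k + n C suc k)) ∎)
  where
  open ≡-Reasoning
  n = 2 ℕ.* k
  k+[1+k]≡1+n : k + suc k ≡ suc n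
  k+[1+k]≡1+n = trans (ℕ.+-suc k k) (cong (λ i → suc (k + i)) (sym (ℕ.+-identityʳ k)))
  symmetric : suc n C k ≡ suc n C suc k
  symmetric = trans (nCk≡nC[n∸k] (ℕ.m≤n⇒m≤1+n (ℕ.m≤m+n k _)))
    (cong (suc n C_) (trans (cong (_∸ k) (sym k+[1+k]≡1+n)) (ℕ.m+n∸m≡n k (suc k))))

-- Both sides satisfy the recurrence of the trinomial triangle.
difference-evenBinomial : ∀ n j → difference n (evenBinomial j) ≡ trinomial n j
difference-evenBinomial zero zero = refl
difference-evenBinomial zero (suc j) = refl
difference-evenBinomial (suc n) zero = begin
  d′           ≡⟨ lemma₁ d′ (D 0) ⟩
  d′ ℤ.+ D 0 ℤ.- D 0 ≡⟨ cong (ℤ._- D 0) (difference-suc n (evenBinomial 0)) ⟩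
  difference n (evenBinomial 0 ∘ suc) ℤ.- D 0
    ≡⟨ cong (ℤ._- D 0) (difference-sum₄ n {f = E 0} {E 1} {E 0} {E 1} evenBinomial-zero) ⟩
  D 0 ℤ.+ (D 1 ℤ.+ (D 0 ℤ.+ D 1)) ℤ.- D 0 ≡⟨ lemma₂ (D 0) (D 1) ⟩
  D 0 ℤ.+ D 1 ℤ.+ D 1
    ≡⟨ cong₂ (λ x y → x ℤ.+ y ℤ.+ y) (difference-evenBinomial n 0) (difference-evenBinomial n 1) ⟩
  trinomial (suc n) 0 ∎
  where
  open ≡-Reasoning
  E = evenBinomial
  D = λ j → difference n (evenBinomial j)
  d′ = difference (suc n) (evenBinomial 0)
  lemma₁ : ∀ x y → x ≡ x ℤ.+ y ℤ.- y
  lemma₁ = ℤ-Ring.solve-∀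
  lemma₂ : ∀ x y → x ℤ.+ (y ℤ.+ (x ℤ.+ y)) ℤ.- x ≡ x ℤ.+ y ℤ.+ y
  lemma₂ = ℤ-Ring.solve-∀
difference-evenBinomial (suc n) (suc j) = begin
  d′           ≡⟨ lemma₁ d′ (D (1 + j)) ⟩
  d′ ℤ.+ D (1 + j) ℤ.- D (1 + j) ≡⟨ cong (ℤ._- D (1 + j)) (difference-suc n (evenBinomial (suc j))) ⟩
  difference n (evenBinomial (suc j) ∘ suc) ℤ.- D (1 + j)
    ≡⟨ cong (ℤ._- D (1 + j))
         (difference-sum₄ n {f = E j} {E (1 + j)} {E (1 + j)} {E (2 + j)} (evenBinomial-suc j)) ⟩
  D j ℤ.+ (D (1 + j) ℤ.+ (D (1 + j) ℤ.+ D (2 + j))) ℤ.- D (1 + j) ≡⟨ lemma₂ (D j) (D (1 + j)) (D (2 + j)) ⟩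
  D j ℤ.+ D (1 + j) ℤ.+ D (2 + j)
    ≡⟨ cong₂ ℤ._+_ (cong₂ ℤ._+_ (difference-evenBinomial n j) (difference-evenBinomial n (1 + j)))
                   (difference-evenBinomial n (2 + j)) ⟩
  trinomial (suc n) (suc j) ∎
  where
  open ≡-Reasoning
  E = evenBinomial
  D = λ j → difference n (evenBinomial j)
  d′ = difference (suc n) (evenBinomial (suc j))
  lemma₁ : ∀ x y → x ≡ x ℤ.+ y ℤ.- y
  lemma₁ = ℤ-Ring.solve-∀
  lemma₂ : ∀ x y z → x ℤ.+ (y ℤ.+ (y ℤ.+ z)) ℤ.- y ≡ x ℤ.+ y ℤ.+ z
  lemma₂ = ℤ-Ring.solve-∀

a≡trinomial : ∀ n → a n ≡ trinomial n 0
a≡trinomial n = difference-evenBinomial n 0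

-- The ring of formal power series

constant : ℚ → Series
constant c zero    = c
constant c (suc n) = 0ℚ

infix 8 ⊝_
⊝_ : Series → Series
(⊝ f) n = ℚ.- f n

scale : ℚ → Series → Series
scale c f n = c ℚ.* f n

⊛-cong : ∀ {f f′ g g′} → f ≗ f′ → g ≗ g′ → f ⊛ g ≗ f′ ⊛ g′
⊛-cong f≗ g≗ zero = cong (ℚ._+ 0ℚ) (cong₂ ℚ._*_ (f≗ 0) (g≗ 0))
⊛-cong f≗ g≗ (suc n) =
  cong₂ ℚ._+_ (cong₂ ℚ._*_ (f≗ 0) (g≗ (suc n))) (⊛-cong (f≗ ∘ suc) g≗ n)

⊛-distribʳ-⊕ : ∀ h f g → (f ⊕ g) ⊛ h ≗ f ⊛ h ⊕ g ⊛ h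
⊛-distribʳ-⊕ h f g zero =
  solve 3 (λ a b c → (a :+ b) :* c :+ κ 0ℚ := (a :* c :+ κ 0ℚ) :+ (b :* c :+ κ 0ℚ))
    refl (f 0) (g 0) (h 0)
  where open +-*-Solver renaming (con to κ)
⊛-distribʳ-⊕ h f g (suc n) = trans
  (cong ((f 0 ℚ.+ g 0) ℚ.* h (suc n) ℚ.+_) (⊛-distribʳ-⊕ h (f ∘ suc) (g ∘ suc) n))
  (solve 5 (λ a b c x y → (a :+ b) :* c :+ (x :+ y) := (a :* c :+ x) :+ (b :* c :+ y))
    refl (f 0) (g 0) (h (suc n)) (((f ∘ suc) ⊛ h) n) (((g ∘ suc) ⊛ h) n))
  where open +-*-Solver renaming (con to κ)

scale-⊛ : ∀ c f g → scale c f ⊛ g ≗ scale c (f ⊛ g)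
scale-⊛ c f g zero =
  solve 3 (λ c a b → c :* a :* b :+ κ 0ℚ := c :* (a :* b :+ κ 0ℚ)) refl c (f 0) (g 0)
  where open +-*-Solver renaming (con to κ)
scale-⊛ c f g (suc n) = trans
  (cong (c ℚ.* f 0 ℚ.* g (suc n) ℚ.+_) (scale-⊛ c (f ∘ suc) g n))
  (solve 4 (λ c a b x → c :* a :* b :+ c :* x := c :* (a :* b :+ x))
    refl c (f 0) (g (suc n)) (((f ∘ suc) ⊛ g) n))
  where open +-*-Solver renaming (con to κ)

⊛-assoc : ∀ f g h → (f ⊛ g) ⊛ h ≗ f ⊛ (g ⊛ h)
⊛-assoc f g h zero =
  solve 3 (λ a b c → (a :* b :+ κ 0ℚ) :* c :+ κ 0ℚ := a :* (b :* c :+ κ 0ℚ) :+ κ 0ℚ)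
    refl (f 0) (g 0) (h 0)
  where open +-*-Solver renaming (con to κ)
⊛-assoc f g h (suc n) = begin
  (f ⊛ g) 0 ℚ.* h (suc n) ℚ.+ ((scale (f 0) (g ∘ suc) ⊕ (f ∘ suc) ⊛ g) ⊛ h) n
    ≡⟨ cong ((f ⊛ g) 0 ℚ.* h (suc n) ℚ.+_) (trans
         (⊛-distribʳ-⊕ h (scale (f 0) (g ∘ suc)) ((f ∘ suc) ⊛ g) n)
         (cong₂ ℚ._+_ (scale-⊛ (f 0) (g ∘ suc) h n) (⊛-assoc (f ∘ suc) g h n))) ⟩
  (f 0 ℚ.* g 0 ℚ.+ 0ℚ) ℚ.* h (suc n)
    ℚ.+ (f 0 ℚ.* ((g ∘ suc) ⊛ h) n ℚ.+ ((f ∘ suc) ⊛ (g ⊛ h)) n)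
    ≡⟨ solve 5 (λ a b c x y → (a :* b :+ κ 0ℚ) :* c :+ (a :* x :+ y) := a :* (b :* c :+ x) :+ y)
         refl (f 0) (g 0) (h (suc n)) (((g ∘ suc) ⊛ h) n) (((f ∘ suc) ⊛ (g ⊛ h)) n) ⟩
  f 0 ℚ.* (g ⊛ h) (suc n) ℚ.+ ((f ∘ suc) ⊛ (g ⊛ h)) n ∎
  where
  open ≡-Reasoning
  open +-*-Solver renaming (con to κ)

-- Unfolding at the right factor, in contrast to the defining recursion.
⊛-sucʳ : ∀ f g n → (f ⊛ g) (suc n) ≡ f (suc n) ℚ.* g 0 ℚ.+ (f ⊛ (g ∘ suc)) n
⊛-sucʳ f g zero =
  solve 4 (λ a a′ b b′ → a :* b′ :+ (a′ :* b :+ κ 0ℚ) := a′ :* b :+ (a :* b′ :+ κ 0ℚ))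
    refl (f 0) (f 1) (g 0) (g 1)
  where open +-*-Solver renaming (con to κ)
⊛-sucʳ f g (suc n) = trans
  (cong (f 0 ℚ.* g (suc (suc n)) ℚ.+_) (⊛-sucʳ (f ∘ suc) g n))
  (solve 5 (λ a b c d x → a :* b :+ (c :* d :+ x) := c :* d :+ (a :* b :+ x))
    refl (f 0) (g (suc (suc n))) (f (suc (suc n))) (g 0) (((f ∘ suc) ⊛ (g ∘ suc)) n))
  where open +-*-Solver renaming (con to κ)

⊛-comm : ∀ f g → f ⊛ g ≗ g ⊛ f
⊛-comm f g zero = cong (ℚ._+ 0ℚ) (ℚ.*-comm (f 0) (g 0))
⊛-comm f g (suc n) = trans
  (cong₂ ℚ._+_ (ℚ.*-comm (f 0) (g (suc n))) (⊛-comm (f ∘ suc) g n))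
  (sym (⊛-sucʳ g f n))

0⊛ : ∀ f → (λ _ → 0ℚ) ⊛ f ≗ (λ _ → 0ℚ)
0⊛ f zero = trans (ℚ.+-identityʳ _) (ℚ.*-zeroˡ (f 0))
0⊛ f (suc n) = cong₂ ℚ._+_ (ℚ.*-zeroˡ (f (suc n))) (0⊛ f n)

constant-⊛ : ∀ c f n → (constant c ⊛ f) n ≡ c ℚ.* f n
constant-⊛ c f zero    = ℚ.+-identityʳ _
constant-⊛ c f (suc n) = trans (cong (c ℚ.* f (suc n) ℚ.+_) (0⊛ f n)) (ℚ.+-identityʳ _)

X-⊛ : ∀ f n → (X ⊛ f) (suc n) ≡ f n
X-⊛ f n = trans (cong (ℚ._+ ((X ∘ suc) ⊛ f) n) (ℚ.*-zeroˡ (f (suc n))))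
  (trans (ℚ.+-identityˡ _)
  (trans (⊛-cong {g = f} X∘suc (λ _ → refl) n)
  (trans (constant-⊛ 1ℚ f n) (ℚ.*-identityˡ (f n)))))
  where
  X∘suc : X ∘ suc ≗ constant 1ℚ
  X∘suc zero    = refl
  X∘suc (suc n) = refl

con≗constant : ∀ c → con c ≗ constant (fromℤ (+ c))
con≗constant c zero = refl
con≗constant c (suc n) = refl

⊕-⊛-commutativeRing : CommutativeRing 0ℓ 0ℓ
⊕-⊛-commutativeRing = record
  { Carrier = Series ; _≈_ = _≗_ ; _+_ = _⊕_ ; _*_ = _⊛_ ; -_ = ⊝_
  ; 0# = constant 0ℚ ; 1# = constant 1ℚ
  ; isCommutativeRing = record
    { isRing = record
      { +-isAbelianGroup = record
        { isGroup = record
          { isMonoid = record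
            { isSemigroup = record
              { isMagma = record
                { isEquivalence = Setoid.isEquivalence (ℕ →-setoid ℚ)
                ; ∙-cong = λ f≗ g≗ n → cong₂ ℚ._+_ (f≗ n) (g≗ n) }
              ; assoc = λ f g h n → ℚ.+-assoc (f n) (g n) (h n) }
            ; identity = (λ { f zero → ℚ.+-identityˡ (f 0) ; f (suc n) → ℚ.+-identityˡ (f (suc n)) })
                       , (λ { f zero → ℚ.+-identityʳ (f 0) ; f (suc n) → ℚ.+-identityʳ (f (suc n)) }) }
          ; inverse = (λ { f zero → ℚ.+-inverseˡ (f 0) ; f (suc n) → ℚ.+-inverseˡ (f (suc n)) })
                    , (λ { f zero → ℚ.+-inverseʳ (f 0) ; f (suc n) → ℚ.+-inverseʳ (f (suc n)) })
          ; ⁻¹-cong = λ f≗ n → cong ℚ.-_ (f≗ n) }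
        ; comm = λ f g n → ℚ.+-comm (f n) (g n) }
      ; *-cong = ⊛-cong
      ; *-assoc = ⊛-assoc
      ; *-identity = ⊛-identityˡ , λ f n → trans (⊛-comm f (constant 1ℚ) n) (⊛-identityˡ f n)
      ; distrib = (λ f g h n → trans (⊛-comm f (g ⊕ h) n) (trans (⊛-distribʳ-⊕ f g h n)
                     (cong₂ ℚ._+_ (⊛-comm g f n) (⊛-comm h f n))))
                , ⊛-distribʳ-⊕ }
    ; *-comm = ⊛-comm } }
  where
  ⊛-identityˡ : ∀ f → constant 1ℚ ⊛ f ≗ f
  ⊛-identityˡ f n = trans (constant-⊛ 1ℚ f n) (ℚ.*-identityˡ (f n))

-- With rational constants as coefficients, polynomial identities between power series
-- are proved by normalisation.
constant-morphism : CommutativeRing.rawRing ℚ.+-*-commutativeRing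
  -Raw-AlmostCommutative⟶ fromCommutativeRing ⊕-⊛-commutativeRing
constant-morphism = record
  { ⟦_⟧    = constant
  ; +-homo = λ { c d zero → refl ; c d (suc n) → refl }
  ; *-homo = λ { c d zero → sym (constant-⊛ c (constant d) 0)
               ; c d (suc n) → sym (trans (constant-⊛ c (constant d) (suc n)) (ℚ.*-zeroʳ c)) }
  ; -‿homo = λ { c zero → refl ; c (suc n) → refl }
  ; 0-homo = λ _ → refl
  ; 1-homo = λ _ → refl
  }

decideConstant : ∀ c d → Maybe (constant c ≗ constant d)
decideConstant c d with c ℚ.≟ d
... | yes c≡d = just (λ n → cong (λ e → constant e n) c≡d)
... | no  _   = nothing

module Series-Solver = Algebra.Solver.Ring _ (fromCommutativeRing ⊕-⊛-commutativeRing) constant-morphism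
  decideConstant

-- Integers as rationals

fromℤ≡/1 : ∀ i → i ℚ./ 1 ≡ fromℤ i
fromℤ≡/1 i = ℚ.fromℚᵘ-toℚᵘ (fromℤ i)

fromℤ-+ : ∀ i j → fromℤ (i ℤ.+ j) ≡ fromℤ i ℚ.+ fromℤ j
fromℤ-+ i j = trans (sym (fromℤ≡/1 (i ℤ.+ j)))
  (cong (ℚ._/ 1) (cong₂ ℤ._+_ (sym (ℤ.*-identityʳ i)) (sym (ℤ.*-identityʳ j))))

fromℤ-* : ∀ i j → fromℤ (i ℤ.* j) ≡ fromℤ i ℚ.* fromℤ j
fromℤ-* i j = sym (fromℤ≡/1 (i ℤ.* j))

fromℤ-neg : ∀ i → fromℤ (ℤ.- i) ≡ ℚ.- fromℤ i
fromℤ-neg (+ zero)  = refl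
fromℤ-neg (+ suc n) = refl
fromℤ-neg -[1+ n ]  = refl

-- The generating function of the central trinomial coefficients

open CommutativeRing ⊕-⊛-commutativeRing using (+-cong; *-cong; -‿cong)
  renaming (refl to ≗-refl; sym to ≗-sym; trans to ≗-trans)

module ≗-Reasoning = SetoidReasoning (CommutativeRing.setoid ⊕-⊛-commutativeRing)

1ₛ 2ₛ 3ₛ 4ₛ : Series
1ₛ = constant 1ℚ
2ₛ = constant (fromℤ (+ 2))
3ₛ = constant (fromℤ (+ 3))
4ₛ = constant (fromℤ (+ 4))

-- S is the square root, 1 - x - 2xY its decomposition, and A its inverse.
module Central (S Y A : Series)
  (S² : S ⊛ S ≗ (1ₛ ⊕ X) ⊛ (1ₛ ⊖ 3ₛ ⊛ X))
  (S-Y : S ≗ 1ₛ ⊖ X ⊖ 2ₛ ⊛ (X ⊛ Y))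
  (A-S : A ⊛ S ≗ 1ₛ)
  where
  open Series-Solver renaming (con to κ)

  private
    k₁ k₂ k₃ k₄ : ∀ {n} → Polynomial n
    k₁ = κ 1ℚ
    k₂ = κ (fromℤ (+ 2))
    k₃ = κ (fromℤ (+ 3))
    k₄ = κ (fromℤ (+ 4))

  -- Y = x (1 + Y + Y²) multiplied by 4x: the difference of the sides is S² - (1+x)(1-3x).
  Y-scaled : 4ₛ ⊛ (X ⊛ Y) ≗ 4ₛ ⊛ (X ⊛ (X ⊛ (1ₛ ⊕ Y ⊕ Y ⊛ Y)))
  Y-scaled = begin
    4ₛ ⊛ (X ⊛ Y)
      ≈⟨ solve 2 (λ x y → k₄ :* (x :* y) :=
           k₄ :* (x :* (x :* (k₁ :+ y :+ y :* y)))
           :- ((k₁ :- x :- k₂ :* (x :* y)) :* (k₁ :- x :- k₂ :* (x :* y))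
               :- (k₁ :+ x) :* (k₁ :- k₃ :* x)))
           (λ _ → refl) X Y ⟩
    Z ⊖ ((1ₛ ⊖ X ⊖ 2ₛ ⊛ (X ⊛ Y)) ⊛ (1ₛ ⊖ X ⊖ 2ₛ ⊛ (X ⊛ Y)) ⊖ P)
      ≈⟨ +-cong (≗-refl {Z}) (-‿cong (+-cong
           (≗-trans (*-cong (≗-sym S-Y) (≗-sym S-Y)) S²) (≗-refl {⊝ P}))) ⟩
    Z ⊖ (P ⊖ P)
      ≈⟨ solve 2 (λ z p → z :- (p :- p) := z) (λ _ → refl) Z P ⟩
    Z ∎
    where
    open ≗-Reasoning
    Z = 4ₛ ⊛ (X ⊛ (X ⊛ (1ₛ ⊕ Y ⊕ Y ⊛ Y)))
    P = (1ₛ ⊕ X) ⊛ (1ₛ ⊖ 3ₛ ⊛ X)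

  Y-quadratic : Y ≗ X ⊛ (1ₛ ⊕ Y ⊕ Y ⊛ Y)
  Y-quadratic n = begin
    Y n                     ≡⟨ quarter (Y n) ⟨
    ¼ ℚ.* (4ℚ ℚ.* Y n)      ≡⟨ cong (¼ ℚ.*_) cancel-X ⟩
    ¼ ℚ.* (4ℚ ℚ.* Z n)      ≡⟨ quarter (Z n) ⟩
    Z n                     ∎
    where
    open ≡-Reasoning
    Z = X ⊛ (1ₛ ⊕ Y ⊕ Y ⊛ Y)
    4ℚ = fromℤ (+ 4)
    ¼ = 1ℚ ℚ.÷ 4ℚ
    coefficient : ∀ f → (4ₛ ⊛ (X ⊛ f)) (suc n) ≡ 4ℚ ℚ.* f n
    coefficient f = trans (constant-⊛ 4ℚ (X ⊛ f) (suc n)) (cong (4ℚ ℚ.*_) (X-⊛ f n))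
    cancel-X : 4ℚ ℚ.* Y n ≡ 4ℚ ℚ.* Z n
    cancel-X = trans (sym (coefficient Y)) (trans (Y-scaled (suc n)) (coefficient Z))
    quarter : ∀ q → ¼ ℚ.* (4ℚ ℚ.* q) ≡ q
    quarter q = trans (sym (ℚ.*-assoc ¼ 4ℚ q)) (ℚ.*-identityˡ q)

  -- The generating function of the j-th column of the trinomial triangle.
  column : ℕ → Series
  column j = A ⊛ Y ^^ j

  column-zero : column 0 ≗ 1ₛ ⊕ X ⊛ (column 0 ⊕ column 1 ⊕ column 1)
  column-zero = begin
    A ⊛ con 1 ≈⟨ *-cong (≗-refl {A}) (con≗constant 1) ⟩
    A ⊛ 1ₛ
      ≈⟨ solve 3 (λ a x y → a :* k₁ := a :* (k₁ :- x :- k₂ :* (x :* y))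
             :+ x :* (a :* k₁ :+ a :* (y :* k₁) :+ a :* (y :* k₁)))
           (λ _ → refl) A X Y ⟩
    A ⊛ (1ₛ ⊖ X ⊖ 2ₛ ⊛ (X ⊛ Y)) ⊕ X ⊛ (A ⊛ 1ₛ ⊕ A ⊛ (Y ⊛ 1ₛ) ⊕ A ⊛ (Y ⊛ 1ₛ))
      ≈⟨ +-cong (≗-trans (*-cong (≗-refl {A}) (≗-sym S-Y)) A-S)
          (*-cong (≗-refl {X}) (+-cong (+-cong (*-cong (≗-refl {A}) one) one-Y) one-Y)) ⟩
    1ₛ ⊕ X ⊛ (column 0 ⊕ column 1 ⊕ column 1) ∎
    where
    open ≗-Reasoning
    one : 1ₛ ≗ con 1
    one = ≗-sym {con 1} {1ₛ} (con≗constant 1)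
    one-Y : A ⊛ (Y ⊛ 1ₛ) ≗ column 1
    one-Y = *-cong (≗-refl {A}) (*-cong (≗-refl {Y}) one)

  column-suc : ∀ j → column (suc j) ≗ X ⊛ (column j ⊕ column (1 + j) ⊕ column (2 + j))
  column-suc j = begin
    A ⊛ (Y ⊛ W)
      ≈⟨ *-cong (≗-refl {A}) (*-cong Y-quadratic (≗-refl {W})) ⟩
    A ⊛ (X ⊛ (1ₛ ⊕ Y ⊕ Y ⊛ Y) ⊛ W)
      ≈⟨ solve 4 (λ a x y w → a :* (x :* (k₁ :+ y :+ y :* y) :* w) :=
            x :* (a :* w :+ a :* (y :* w) :+ a :* (y :* (y :* w)))) (λ _ → refl) A X Y W ⟩
    X ⊛ (A ⊛ W ⊕ A ⊛ (Y ⊛ W) ⊕ A ⊛ (Y ⊛ (Y ⊛ W))) ∎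
    where
    open ≗-Reasoning
    W = Y ^^ j

  fromℤ-+₃ : ∀ i j k → fromℤ (i ℤ.+ j ℤ.+ k) ≡ fromℤ i ℚ.+ fromℤ j ℚ.+ fromℤ k
  fromℤ-+₃ i j k = trans (fromℤ-+ (i ℤ.+ j) k) (cong (ℚ._+ fromℤ k) (fromℤ-+ i j))

  X-⊛-zero : ∀ f → (X ⊛ f) 0 ≡ 0ℚ
  X-⊛-zero f = cong (ℚ._+ 0ℚ) (ℚ.*-zeroˡ (f 0))

  -- Coefficient n + 1 of each column is determined by coefficients n of the columns.
  column-trinomial : ∀ n j → column j n ≡ fromℤ (trinomial n j)
  column-trinomial zero zero = trans (column-zero 0)
    (cong (1ℚ ℚ.+_) (X-⊛-zero (column 0 ⊕ column 1 ⊕ column 1)))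
  column-trinomial zero (suc j) = trans (column-suc j 0)
    (X-⊛-zero (column j ⊕ column (1 + j) ⊕ column (2 + j)))
  column-trinomial (suc n) zero = begin
    column 0 (suc n)
      ≡⟨ column-zero (suc n) ⟩
    0ℚ ℚ.+ (X ⊛ (column 0 ⊕ column 1 ⊕ column 1)) (suc n)
      ≡⟨ trans (ℚ.+-identityˡ _) (X-⊛ (column 0 ⊕ column 1 ⊕ column 1) n) ⟩
    column 0 n ℚ.+ column 1 n ℚ.+ column 1 n
      ≡⟨ cong₂ (λ p q → p ℚ.+ q ℚ.+ q) (column-trinomial n 0) (column-trinomial n 1) ⟩
    fromℤ (trinomial n 0) ℚ.+ fromℤ (trinomial n 1) ℚ.+ fromℤ (trinomial n 1)
      ≡⟨ fromℤ-+₃ (trinomial n 0) (trinomial n 1) (trinomial n 1) ⟨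
    fromℤ (trinomial (suc n) 0) ∎
    where open ≡-Reasoning
  column-trinomial (suc n) (suc j) = begin
    column (suc j) (suc n)
      ≡⟨ trans (column-suc j (suc n)) (X-⊛ (column j ⊕ column (1 + j) ⊕ column (2 + j)) n) ⟩
    column j n ℚ.+ column (1 + j) n ℚ.+ column (2 + j) n
      ≡⟨ cong₂ ℚ._+_ (cong₂ ℚ._+_ (column-trinomial n j) (column-trinomial n (1 + j)))
                     (column-trinomial n (2 + j)) ⟩
    fromℤ (trinomial n j) ℚ.+ fromℤ (trinomial n (1 + j)) ℚ.+ fromℤ (trinomial n (2 + j))
      ≡⟨ fromℤ-+₃ (trinomial n j) (trinomial n (1 + j)) (trinomial n (2 + j)) ⟨
    fromℤ (trinomial (suc n) (suc j)) ∎
    where open ≡-Reasoning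

  A-coefficient : ∀ n → A n ≡ fromℤ (a n)
  A-coefficient n = begin
    A n                     ≡⟨ ℚ.*-identityˡ (A n) ⟨
    1ℚ ℚ.* A n              ≡⟨ constant-⊛ 1ℚ A n ⟨
    (1ₛ ⊛ A) n              ≡⟨ ⊛-cong {g = A} (con≗constant 1) (λ _ → refl) n ⟨
    (con 1 ⊛ A) n           ≡⟨ ⊛-comm (con 1) A n ⟩
    column 0 n              ≡⟨ column-trinomial n 0 ⟩
    fromℤ (trinomial n 0)   ≡⟨ cong fromℤ (a≡trinomial n) ⟨
    fromℤ (a n)             ∎
    where open ≡-Reasoning

-- The coefficients of the Laurent series

-- The series rootTail is Y in √((1+x)(1-3x)) = 1 - x - 2xY.
radicand root inverseRoot rootTail : Series
radicand = (con 1 ⊕ X) ⊛ (con 1 ⊖ con 3 ⊛ X)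
root = √ radicand
inverseRoot = con 1 ⊘ root
rootTail n = ℚ.- ½ ℚ.* (root (suc n) ℚ.- (1ₛ (suc n) ℚ.- X (suc n)))

radicand≗ : radicand ≗ (1ₛ ⊕ X) ⊛ (1ₛ ⊖ 3ₛ ⊛ X)
radicand≗ = *-cong {con 1 ⊕ X} {1ₛ ⊕ X}
  (+-cong {con 1} {1ₛ} {X} {X} (con≗constant 1) (≗-refl {X}))
  (+-cong {con 1} {1ₛ} (con≗constant 1) (-‿cong (*-cong (con≗constant 3) (≗-refl {X}))))

root² : root ⊛ root ≗ (1ₛ ⊕ X) ⊛ (1ₛ ⊖ 3ₛ ⊛ X)
root² n = trans (√-correct radicand refl n) (radicand≗ n)

root≗ : root ≗ 1ₛ ⊖ X ⊖ 2ₛ ⊛ (X ⊛ rootTail)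
root≗ zero = sym (cong (λ q → 1ℚ ℚ.- (fromℤ (+ 2) ℚ.* (q ℚ.+ 0ℚ) ℚ.+ 0ℚ)) (ℚ.*-zeroˡ (rootTail 0)))
root≗ (suc n) = sym (trans
  (cong (λ q → c ℚ.- q) (trans (constant-⊛ (fromℤ (+ 2)) (X ⊛ rootTail) (suc n))
    (cong (fromℤ (+ 2) ℚ.*_) (X-⊛ rootTail n))))
  (solve 2 (λ c r → c :- κ (fromℤ (+ 2)) :* (κ (ℚ.- ½) :* (r :- c)) := r) refl c (root (suc n))))
  where
  open +-*-Solver renaming (con to κ)
  c = 1ₛ (suc n) ℚ.- X (suc n)

inverseRoot-root : inverseRoot ⊛ root ≗ 1ₛ
inverseRoot-root n = trans (⊘-correct (con 1) root n) (con≗constant 1 n)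

open Central root rootTail inverseRoot root² root≗ inverseRoot-root using (A-coefficient)

-- 3x³ + x² - 3x + 1
numerator : Series
numerator = con 3 ⊛ X ^^ 3 ⊕ X ^^ 2 ⊖ con 3 ⊛ X ⊕ con 1

half : ∀ {p q} → p ℚ.* fromℤ (+ 2) ≡ q → p ≡ ½ ℚ.* q
half {p} refl = solve 1 (λ p → p := κ ½ :* (p :* κ (fromℤ (+ 2)))) refl p
  where open +-*-Solver renaming (con to κ)

half-series : ∀ {f g} → f ⊛ 2ₛ ≗ g → ∀ n → f n ≡ ½ ℚ.* g n
half-series {f} {g} f⊛2≗g n = half (begin
  f n ℚ.* fromℤ (+ 2) ≡⟨ ℚ.*-comm (f n) (fromℤ (+ 2)) ⟩
  fromℤ (+ 2) ℚ.* f n ≡⟨ constant-⊛ (fromℤ (+ 2)) f n ⟨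
  (2ₛ ⊛ f) n          ≡⟨ ⊛-comm 2ₛ f n ⟩
  (f ⊛ 2ₛ) n          ≡⟨ f⊛2≗g n ⟩
  g n                 ∎)
  where open ≡-Reasoning

numerator-⊛ : ∀ A → numerator ⊛ A ≗
  3ₛ ⊛ (X ⊛ (X ⊛ (X ⊛ A))) ⊕ X ⊛ (X ⊛ A) ⊖ 3ₛ ⊛ (X ⊛ A) ⊕ A
numerator-⊛ A = begin
  numerator ⊛ A
    ≈⟨ *-cong {numerator} {numerator′} numerator≗ (≗-refl {A}) ⟩
  numerator′ ⊛ A
    ≈⟨ solve 2 (λ x a →
         (k₃ :* (x :* (x :* (x :* k₁))) :+ x :* (x :* k₁) :- k₃ :* x :+ k₁) :* a
         := k₃ :* (x :* (x :* (x :* a))) :+ x :* (x :* a) :- k₃ :* (x :* a) :+ a)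
         (λ _ → refl) X A ⟩
  3ₛ ⊛ (X ⊛ (X ⊛ (X ⊛ A))) ⊕ X ⊛ (X ⊛ A) ⊖ 3ₛ ⊛ (X ⊛ A) ⊕ A ∎
  where
  open ≗-Reasoning
  open Series-Solver renaming (con to κ)
  k₁ k₃ : ∀ {n} → Polynomial n
  k₁ = κ 1ℚ
  k₃ = κ (fromℤ (+ 3))
  numerator′ : Series
  numerator′ = 3ₛ ⊛ (X ⊛ (X ⊛ (X ⊛ 1ₛ))) ⊕ X ⊛ (X ⊛ 1ₛ) ⊖ 3ₛ ⊛ X ⊕ 1ₛ
  X-cong : ∀ {f g} → f ≗ g → X ⊛ f ≗ X ⊛ g
  X-cong = *-cong (≗-refl {X})
  numerator≗ : numerator ≗ numerator′
  numerator≗ = +-cong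
    (+-cong
      (+-cong (*-cong (con≗constant 3) (X-cong (X-cong (X-cong (con≗constant 1)))))
              (X-cong (X-cong (con≗constant 1))))
      (-‿cong (*-cong (con≗constant 3) (≗-refl {X}))))
    (con≗constant 1)

numerator-⊛-coefficient : ∀ A n → (numerator ⊛ A) (3 + n) ≡
  fromℤ (+ 3) ℚ.* A n ℚ.+ A (1 + n) ℚ.- fromℤ (+ 3) ℚ.* A (2 + n) ℚ.+ A (3 + n)
numerator-⊛-coefficient A n = trans (numerator-⊛ A (3 + n))
  (cong (ℚ._+ A (3 + n)) (cong₂ ℚ._-_ (cong₂ ℚ._+_
    (trans (constant-⊛ (fromℤ (+ 3)) (X ⊛ (X ⊛ (X ⊛ A))) (3 + n)) (cong (fromℤ (+ 3) ℚ.*_)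
      (trans (X-⊛ (X ⊛ (X ⊛ A)) (2 + n)) (trans (X-⊛ (X ⊛ A) (1 + n)) (X-⊛ A n)))))
    (trans (X-⊛ (X ⊛ A) (2 + n)) (X-⊛ A (1 + n))))
    (trans (constant-⊛ (fromℤ (+ 3)) (X ⊛ A) (3 + n)) (cong (fromℤ (+ 3) ℚ.*_) (X-⊛ A (2 + n))))))

fraction : Series
fraction = numerator ⊘ (con 2 ⊛ root)

fraction≗ : ∀ n → fraction n ≡ ½ ℚ.* (numerator ⊛ inverseRoot) n
fraction≗ = half-series {fraction} twice
  where
  open ≗-Reasoning
  open Series-Solver renaming (con to κ)
  twice : fraction ⊛ 2ₛ ≗ numerator ⊛ inverseRoot
  twice = begin
    fraction ⊛ 2ₛ
      ≈⟨ solve 2 (λ q d → q :* d := q :* d :* κ 1ℚ) (λ _ → refl) fraction 2ₛ ⟩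
    fraction ⊛ 2ₛ ⊛ 1ₛ
      ≈⟨ *-cong (≗-refl {fraction ⊛ 2ₛ}) (≗-sym {inverseRoot ⊛ root} {1ₛ} inverseRoot-root) ⟩
    fraction ⊛ 2ₛ ⊛ (inverseRoot ⊛ root)
      ≈⟨ solve 4 (λ q d s b → q :* d :* (b :* s) := q :* (d :* s) :* b)
           (λ _ → refl) fraction 2ₛ root inverseRoot ⟩
    fraction ⊛ (2ₛ ⊛ root) ⊛ inverseRoot
      ≈⟨ *-cong (≗-trans
           (*-cong (≗-refl {fraction}) (*-cong (≗-sym {con 2} {2ₛ} (con≗constant 2)) (≗-refl {root})))
           (⊘-correct numerator (con 2 ⊛ root))) (≗-refl {inverseRoot}) ⟩
    numerator ⊛ inverseRoot ∎

-- The combination of central trinomial coefficients that is twice the number of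
-- sequences with n + 1 letters.
combination : ℕ → ℤ
combination n = + 3 ℤ.* a n ℤ.+ a (1 + n) ℤ.- + 3 ℤ.* a (2 + n) ℤ.+ a (3 + n)

fromℤ-combination : ∀ n → fromℤ (combination n) ≡
  fromℤ (+ 3 ℤ.* a n) ℚ.+ fromℤ (a (1 + n)) ℚ.- fromℤ (+ 3 ℤ.* a (2 + n)) ℚ.+ fromℤ (a (3 + n))
fromℤ-combination n =
  trans (fromℤ-+ (+ 3 ℤ.* a n ℤ.+ a (1 + n) ℤ.- + 3 ℤ.* a (2 + n)) (a (3 + n)))
  (cong (ℚ._+ fromℤ (a (3 + n)))
    (trans (fromℤ-+ (+ 3 ℤ.* a n ℤ.+ a (1 + n)) (ℤ.- (+ 3 ℤ.* a (2 + n))))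
           (cong₂ ℚ._+_ (fromℤ-+ (+ 3 ℤ.* a n) (a (1 + n))) (fromℤ-neg (+ 3 ℤ.* a (2 + n))))))

fraction-coefficient : ∀ n → fraction (3 + n) ≡ ½ ℚ.* fromℤ (combination n)
fraction-coefficient n = begin
  fraction (3 + n)
    ≡⟨ fraction≗ (3 + n) ⟩
  ½ ℚ.* (numerator ⊛ inverseRoot) (3 + n)
    ≡⟨ cong (½ ℚ.*_) (numerator-⊛-coefficient inverseRoot n) ⟩
  ½ ℚ.* (fromℤ (+ 3) ℚ.* inverseRoot n ℚ.+ inverseRoot (1 + n)
         ℚ.- fromℤ (+ 3) ℚ.* inverseRoot (2 + n) ℚ.+ inverseRoot (3 + n))
    ≡⟨ cong (½ ℚ.*_) (cong₂ ℚ._+_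
         (cong₂ ℚ._-_ (cong₂ ℚ._+_ (triple n) (A-coefficient (1 + n))) (triple (2 + n)))
         (A-coefficient (3 + n))) ⟩
  ½ ℚ.* (fromℤ (+ 3 ℤ.* a n) ℚ.+ fromℤ (a (1 + n))
         ℚ.- fromℤ (+ 3 ℤ.* a (2 + n)) ℚ.+ fromℤ (a (3 + n)))
    ≡⟨ cong (½ ℚ.*_) (fromℤ-combination n) ⟨
  ½ ℚ.* fromℤ (combination n) ∎
  where
  open ≡-Reasoning
  triple : ∀ m → fromℤ (+ 3) ℚ.* inverseRoot m ≡ fromℤ (+ 3 ℤ.* a m)
  triple m = trans (cong (fromℤ (+ 3) ℚ.*_) (A-coefficient m)) (sym (fromℤ-* (+ 3) (a m)))

combination-trinomial : ∀ n →
  combination n ≡ (trinomial n 0 ℤ.+ trinomial n 1 ℤ.+ trinomial n 3) ℤ.* + 2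
combination-trinomial n = trans
  (cong₂ ℤ._+_
    (cong₂ ℤ._-_
      (cong₂ ℤ._+_ (cong (λ c → + 3 ℤ.* c) (a≡trinomial n)) (a≡trinomial (1 + n)))
      (cong (λ c → + 3 ℤ.* c) (a≡trinomial (2 + n))))
    (a≡trinomial (3 + n)))
  (lemma (trinomial n 0) (trinomial n 1) (trinomial n 2) (trinomial n 3))
  where
  lemma : ∀ x₀ x₁ x₂ x₃ →
    + 3 ℤ.* x₀ ℤ.+ (x₀ ℤ.+ x₁ ℤ.+ x₁)
    ℤ.- + 3 ℤ.* (x₀ ℤ.+ x₁ ℤ.+ x₁ ℤ.+ (x₀ ℤ.+ x₁ ℤ.+ x₂) ℤ.+ (x₀ ℤ.+ x₁ ℤ.+ x₂))
    ℤ.+ (x₀ ℤ.+ x₁ ℤ.+ x₁ ℤ.+ (x₀ ℤ.+ x₁ ℤ.+ x₂) ℤ.+ (x₀ ℤ.+ x₁ ℤ.+ x₂)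
         ℤ.+ (x₀ ℤ.+ x₁ ℤ.+ x₁ ℤ.+ (x₀ ℤ.+ x₁ ℤ.+ x₂) ℤ.+ (x₁ ℤ.+ x₂ ℤ.+ x₃))
         ℤ.+ (x₀ ℤ.+ x₁ ℤ.+ x₁ ℤ.+ (x₀ ℤ.+ x₁ ℤ.+ x₂) ℤ.+ (x₁ ℤ.+ x₂ ℤ.+ x₃)))
    ≡ (x₀ ℤ.+ x₁ ℤ.+ x₃) ℤ.* + 2
  lemma = ℤ-Ring.solve-∀

count-formula : ∀ n → fromℤ (+ completions (suc n) 0 0 2) ≡ ½ ℚ.* fromℤ (combination n)
count-formula n = half (trans (sym (fromℤ-* (+ completions (suc n) 0 0 2) (+ 2)))
  (cong fromℤ (trans (cong (ℤ._* + 2) (completions-trinomial n)) (sym (combination-trinomial n)))))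

-- (1 - x)²
square : Series
square = (con 1 ⊖ X) ^^ 2

square≗ : square ≗ 1ₛ ⊖ 2ₛ ⊛ X ⊕ X ⊛ X
square≗ = begin
  (con 1 ⊖ X) ⊛ ((con 1 ⊖ X) ⊛ con 1)
    ≈⟨ *-cong {con 1 ⊖ X} {1ₛ ⊖ X} one-X
         (*-cong {con 1 ⊖ X} {1ₛ ⊖ X} {con 1} {1ₛ} one-X (con≗constant 1)) ⟩
  (1ₛ ⊖ X) ⊛ ((1ₛ ⊖ X) ⊛ 1ₛ)
    ≈⟨ solve 1 (λ x →
         (κ 1ℚ :- x) :* ((κ 1ℚ :- x) :* κ 1ℚ) := κ 1ℚ :- κ (fromℤ (+ 2)) :* x :+ x :* x)
         (λ _ → refl) X ⟩
  1ₛ ⊖ 2ₛ ⊛ X ⊕ X ⊛ X ∎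
  where
  open ≗-Reasoning
  open Series-Solver renaming (con to κ)
  one-X : con 1 ⊖ X ≗ 1ₛ ⊖ X
  one-X n = cong (ℚ._- X n) (con≗constant 1 n)

square/2-beyond : ∀ n → (square ⊘ con 2) (3 + n) ≡ 0ℚ
square/2-beyond n = begin
  (square ⊘ con 2) (3 + n) ≡⟨ half-series {square ⊘ con 2} {square} twice (3 + n) ⟩
  ½ ℚ.* square (3 + n)     ≡⟨ cong (½ ℚ.*_) (square≗ (3 + n)) ⟩
  ½ ℚ.* (0ℚ ℚ.- (2ₛ ⊛ X) (3 + n) ℚ.+ (X ⊛ X) (3 + n))
    ≡⟨ cong (½ ℚ.*_) (cong₂ (λ p q → 0ℚ ℚ.- p ℚ.+ q)
         (constant-⊛ (fromℤ (+ 2)) X (3 + n)) (X-⊛ X (2 + n))) ⟩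
  0ℚ ∎
  where
  open ≡-Reasoning
  twice : (square ⊘ con 2) ⊛ 2ₛ ≗ square
  twice n = trans
    (⊛-cong {square ⊘ con 2} {g = 2ₛ} {con 2} (λ _ → refl) (λ m → sym (con≗constant 2 m)) n)
    (⊘-correct square (con 2) n)

-- The power series whose quotient by x² is the stated Laurent series.
shiftedGF : Series
shiftedGF n = fraction n ℚ.- (square ⊘ con 2) n

shiftedGF-coefficient : ∀ n → shiftedGF (3 + n) ≡ fromℤ (+ completions (suc n) 0 0 2)
shiftedGF-coefficient n = begin
  shiftedGF (3 + n)
    ≡⟨ cong₂ ℚ._-_ (fraction-coefficient n) (square/2-beyond n) ⟩
  ½ ℚ.* fromℤ (combination n) ℚ.- 0ℚ  ≡⟨ ℚ.+-identityʳ (½ ℚ.* fromℤ (combination n)) ⟩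
  ½ ℚ.* fromℤ (combination n)         ≡⟨ count-formula n ⟨
  fromℤ (+ completions (suc n) 0 0 2) ∎
  where open ≡-Reasoning

coeff-shift : ∀ v f n m → m ≡ v ℤ.+ + n → coeff (x^ v · f) m ≡ f n
coeff-shift v f n m eq with m ℤ.- v | trans (cong (ℤ._- v) eq) (lemma v (+ n))
  where
  lemma : ∀ i j → i ℤ.+ j ℤ.- i ≡ j
  lemma = ℤ-Ring.solve-∀
... | _ | refl = refl

generating-function : ∀ f →
  (∀ n → f n ≡ shiftedGF (2 + n)) →
  x^ + 0 · f ≈
       (x^ + 0 · con 3 ⊛ X ^^ 3 ⊕ X ^^ 2 ⊖ con 3 ⊛ X ⊕ con 1)
         ⊡ (x^ + 2 · con 2 ⊛ √ ((con 1 ⊕ X) ⊛ (con 1 ⊖ con 3 ⊛ X)))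
       ⊟ (x^ + 0 · (con 1 ⊖ X) ^^ 2) ⊡ (x^ + 2 · con 2)
generating-function f eq = coefficients
  where
  -- Both fractions have the leading exponent 0 - 2.
  l r : Laurent
  l = x^ -[1+ 1 ] · fraction
  r = x^ -[1+ 1 ] · (square ⊘ con 2)
  difference-coefficient : ∀ n m → m ≡ -[1+ 1 ] ℤ.+ + n → coeff (l ⊟ r) m ≡ shiftedGF n
  difference-coefficient n m m≡n-2 = trans
    (coeff-shift -[1+ 1 ]
      (λ n → coeff l (-[1+ 1 ] ℤ.+ + n) ℚ.- coeff r (-[1+ 1 ] ℤ.+ + n)) n m m≡n-2)
    (cong₂ ℚ._-_ (coeff-shift -[1+ 1 ] fraction n _ refl)
                 (coeff-shift -[1+ 1 ] (square ⊘ con 2) n _ refl))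
  coefficients : ∀ m → coeff (x^ + 0 · f) m ≡ coeff (l ⊟ r) m
  coefficients (+ n) = trans (coeff-shift (+ 0) f n (+ n) refl)
    (trans (eq n) (sym (difference-coefficient (2 + n) (+ n) refl)))
  -- At x⁻¹ and x⁻² the two fractions cancel, as evaluation shows.
  coefficients -[1+ 0 ] = sym (difference-coefficient 1 _ refl)
  coefficients -[1+ 1 ] = sym (difference-coefficient 0 _ refl)
  coefficients -[1+ suc (suc n) ] = refl

R-completions : ∀ n → R (suc n) ≡ fromℤ (+ completions (suc n) 0 0 2)
R-completions n = cong (λ c → fromℤ (+ c)) (∣I∣-completions n)

R-coefficient : ∀ n → R n ≡ shiftedGF (2 + n)
R-coefficient zero    = refl
R-coefficient (suc n) = trans (R-completions n) (sym (shiftedGF-coefficient n))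

-- The numbers of completions are evaluated by their recurrence.
first-values : applyUpTo R 11 ≡ map (λ c → fromℤ (+ c))
          (0 ∷ 1 ∷ 2 ∷ 5 ∷ 14 ∷ 39 ∷ 111 ∷ 317 ∷ 911 ∷ 2627 ∷ 7600 ∷ [])
first-values = cong (0ℚ ∷_) (cong₂ _∷_ (R-completions 0) (cong₂ _∷_ (R-completions 1)
  (cong₂ _∷_ (R-completions 2) (cong₂ _∷_ (R-completions 3) (cong₂ _∷_ (R-completions 4)
  (cong₂ _∷_ (R-completions 5) (cong₂ _∷_ (R-completions 6) (cong₂ _∷_ (R-completions 7)
  (cong₂ _∷_ (R-completions 8) (cong₂ _∷_ (R-completions 9) refl))))))))))

theorem4p1 : (x^ + 0 · R ≈
    (x^ + 0 · con 3 ⊛ X ^^ 3 ⊕ X ^^ 2 ⊖ con 3 ⊛ X ⊕ con 1)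
    ⊡ (x^ + 2 · con 2 ⊛ √ ((con 1 ⊕ X) ⊛ (con 1 ⊖ con 3 ⊛ X)))
    ⊟ (x^ + 0 · (con 1 ⊖ X) ^^ 2) ⊡ (x^ + 2 · con 2))
    × (applyUpTo R 11 ≡
    map (λ c → fromℤ (+ c))
    (0 ∷ 1 ∷ 2 ∷ 5 ∷ 14 ∷ 39 ∷ 111 ∷ 317 ∷ 911 ∷ 2627 ∷ 7600 ∷ []))
    × (∀ n → 1 ≤ n →
    fromℤ (+ ∣I∣ (n ∸ 1) (τ₀₀₀ ∷ τ₀₂₁ ∷ []))
    ≡ ½ ℚ.* fromℤ (+ 3 ℤ.* a (n ∸ 1) ℤ.+ a n
    ℤ.- + 3 ℤ.* a (n + 1) ℤ.+ a (n + 2)))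
theorem4p1 = generating-function R R-coefficient , first-values , λ { (suc n) _ →
  trans (cong (λ c → fromℤ (+ c)) (∣I∣-completions n)) (trans (count-formula n)
    (cong₂ (λ i j → ½ ℚ.* fromℤ (+ 3 ℤ.* a n ℤ.+ a (suc n) ℤ.- + 3 ℤ.* a i ℤ.+ a j))
      (ℕ.+-comm 1 (suc n)) (ℕ.+-comm 2 (suc n)))) }
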